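{- For any integer $d\ge 2$, there exist a matrix $A\in\mathbb{Z}^{d\times(d+1)}$ with column vectors $a_1,\ldots,a_{d+1}$ and a vector $b\in\mathcal{L}(a_1,\ldots,a_{d+1})$ such that there exist real numbers $$\alpha_1,\ldots,\alpha_{d+1}>\frac{\left(\max_{i=1}^{d+1}\|a_i\|\right)^d}{20\sqrt d}$$ with $b=\sum_{i=1}^{d+1}\alpha_i a_i$, but there do not exist non-negative integers $\beta_1,\ldots,\beta_{d+1}\in\mathbb{Z}_{\ge0}$ such that $b=\sum_{i=1}^{d+1}\beta_i a_i$.
   Context: $\|\cdot\|$ is the Euclidean norm on $\mathbb{R}^d$. $\mathcal{L}(a_1,\ldots,a_{d+1})$ is the set of all integer linear combinations of $a_1,\ldots,a_{d+1}$. -}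

module Defs where

open import Algebra.Bundles.Raw using (RawSemiring)
import Algebra.Definitions.RawSemiring as SemiringDefinitions
open import Data.Bool.Base using (if_then_else_)
open import Data.Integer.Base as ℤ using (ℤ; +_)
import Data.Integer.Properties as ℤ
import Data.Integer.Tactic.RingSolver as ℤSolver
open import Data.Nat.Base as ℕ using (ℕ; zero; suc; z≤n; s≤s)
import Data.Nat.Properties as ℕ
open import Data.Product.Base using (∃-syntax; _×_; _,_; proj₁; proj₂)
open import Data.Rational.Base as ℚ using (ℚ; 0ℚ; 1ℚ; ½)
import Data.Rational.Properties as ℚ
open import Data.Rational.Solver using (module +-*-Solver)
import Data.Rational.Unnormalised.Base as ℚᵘ
import Data.Rational.Unnormalised.Properties as ℚᵘ
open import Data.Sum.Base using (inj₁; inj₂)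
open import Data.Vec.Functional using (Vector; foldr; head; tail; map)
open import Data.Vec.Functional.Relation.Binary.Pointwise using (Pointwise)
open import Level using (0ℓ)
open import Relation.Binary.Core using (Rel)
open import Relation.Binary.PropositionalEquality
open import Relation.Nullary using (¬_; Dec; yes; no; does; contradiction)
open import Relation.Unary using (Pred)

module _ where

  open +-*-Solver using (solve; _:=_; _:+_; _:*_; _:-_; :-_; con)
  open ℚ.≤-Reasoning

  p≤q+r⇒p-q≤r : ∀ {p q r} → p ℚ.≤ q ℚ.+ r → p ℚ.- q ℚ.≤ r
  p≤q+r⇒p-q≤r {p} {q} {r} h = begin
    p ℚ.- q         ≤⟨ ℚ.+-monoˡ-≤ (ℚ.- q) h ⟩
    q ℚ.+ r ℚ.- q   ≡⟨ solve 2 (λ q r → q :+ r :- q := r) refl q r ⟩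
    r               ∎

  p-q≤r⇒p≤q+r : ∀ {p q r} → p ℚ.- q ℚ.≤ r → p ℚ.≤ q ℚ.+ r
  p-q≤r⇒p≤q+r {p} {q} {r} h = begin
    p               ≡⟨ solve 2 (λ p q → p := q :+ (p :- q)) refl p q ⟩
    q ℚ.+ (p ℚ.- q) ≤⟨ ℚ.+-monoʳ-≤ q h ⟩
    q ℚ.+ r         ∎

  p≤∣p∣ : ∀ p → p ℚ.≤ ℚ.∣ p ∣
  p≤∣p∣ p with ℚ.≤-total 0ℚ p
  ... | inj₁ 0≤p = ℚ.≤-reflexive (sym (ℚ.0≤p⇒∣p∣≡p 0≤p))
  ... | inj₂ p≤0 = ℚ.≤-trans p≤0 (ℚ.0≤∣p∣ p)

  ∣p-q∣≡∣q-p∣ : ∀ p q → ℚ.∣ p ℚ.- q ∣ ≡ ℚ.∣ q ℚ.- p ∣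
  ∣p-q∣≡∣q-p∣ p q = trans
    (sym (ℚ.∣-p∣≡∣p∣ (p ℚ.- q)))
    (cong ℚ.∣_∣ (solve 2 (λ p q → :- (p :- q) := q :- p) refl p q))

  ∣p-q∣≤r⇒p≤q+r : ∀ p q {r} → ℚ.∣ p ℚ.- q ∣ ℚ.≤ r → p ℚ.≤ q ℚ.+ r
  ∣p-q∣≤r⇒p≤q+r p q h = p-q≤r⇒p≤q+r (ℚ.≤-trans (p≤∣p∣ (p ℚ.- q)) h)

  ∣p-q∣≤r⇒q≤p+r : ∀ p q {r} → ℚ.∣ p ℚ.- q ∣ ℚ.≤ r → q ℚ.≤ p ℚ.+ r
  ∣p-q∣≤r⇒q≤p+r p q h = ∣p-q∣≤r⇒p≤q+r q p (subst (ℚ._≤ _) (∣p-q∣≡∣q-p∣ p q) h)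

  ∣p-q∣≤r : ∀ p q {r} → p ℚ.≤ q ℚ.+ r → q ℚ.≤ p ℚ.+ r → ℚ.∣ p ℚ.- q ∣ ℚ.≤ r
  ∣p-q∣≤r p q h₁ h₂ with ℚ.∣p∣≡p∨∣p∣≡-p (p ℚ.- q)
  ... | inj₁ eq = subst (ℚ._≤ _) (sym eq) (p≤q+r⇒p-q≤r h₁)
  ... | inj₂ eq = subst (ℚ._≤ _)
    (trans (solve 2 (λ p q → q :- p := :- (p :- q)) refl p q) (sym eq))
    (p≤q+r⇒p-q≤r h₂)

  ∣p-p∣≤ε : ∀ p {ε} → 0ℚ ℚ.< ε → ℚ.∣ p ℚ.- p ∣ ℚ.≤ ε
  ∣p-p∣≤ε p {ε} 0<ε = ∣p-q∣≤r p p p≤p+ε p≤p+ε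
    where
    p≤p+ε : p ℚ.≤ p ℚ.+ ε
    p≤p+ε = ℚ.≤-trans (ℚ.≤-reflexive (sym (ℚ.+-identityʳ p))) (ℚ.+-monoʳ-≤ p (ℚ.<⇒≤ 0<ε))

  *-mono-≤-nonNeg : ∀ {p q r s} → 0ℚ ℚ.≤ p → 0ℚ ℚ.≤ s →
                    p ℚ.≤ q → r ℚ.≤ s → p ℚ.* r ℚ.≤ q ℚ.* s
  *-mono-≤-nonNeg {p} {q} {r} {s} 0≤p 0≤s p≤q r≤s = begin
    p ℚ.* r  ≤⟨ ℚ.*-monoˡ-≤-nonNeg p {{ℚ.nonNegative 0≤p}} r≤s ⟩
    p ℚ.* s  ≤⟨ ℚ.*-monoʳ-≤-nonNeg s {{ℚ.nonNegative 0≤s}} p≤q ⟩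
    q ℚ.* s  ∎

  p≤q⇒p²≤q² : ∀ {p q} → 0ℚ ℚ.≤ p → p ℚ.≤ q → p ℚ.* p ℚ.≤ q ℚ.* q
  p≤q⇒p²≤q² 0≤p p≤q = *-mono-≤-nonNeg 0≤p (ℚ.≤-trans 0≤p p≤q) p≤q p≤q

  0≤p*q : ∀ {p q} → 0ℚ ℚ.≤ p → 0ℚ ℚ.≤ q → 0ℚ ℚ.≤ p ℚ.* q
  0≤p*q {p} {q} 0≤p 0≤q = ℚ.nonNegative⁻¹ _
    {{ℚ.nonNeg*nonNeg⇒nonNeg p {{ℚ.nonNegative 0≤p}} q {{ℚ.nonNegative 0≤q}}}}

  0<p*q : ∀ {p q} → 0ℚ ℚ.< p → 0ℚ ℚ.< q → 0ℚ ℚ.< p ℚ.* q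
  0<p*q {p} {q} 0<p 0<q = ℚ.positive⁻¹ _
    {{ℚ.pos*pos⇒pos p {{ℚ.positive 0<p}} q {{ℚ.positive 0<q}}}}

  0<½*p : ∀ {p} → 0ℚ ℚ.< p → 0ℚ ℚ.< ½ ℚ.* p
  0<½*p = 0<p*q (ℚ.positive⁻¹ ½)

  ½*p+½*p≡p : ∀ p → ½ ℚ.* p ℚ.+ ½ ℚ.* p ≡ p
  ½*p+½*p≡p = solve 1 (λ p → con ½ :* p :+ con ½ :* p := p) refl

  1/p-pos : ∀ p (0<p : 0ℚ ℚ.< p) → 0ℚ ℚ.< (ℚ.1/ p) {{ℚ.>-nonZero 0<p}}
  1/p-pos p 0<p = ℚ.positive⁻¹ _ {{ℚ.1/pos⇒pos p {{ℚ.positive 0<p}}}}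

  1/-antimono-≤ : ∀ p q (0<p : 0ℚ ℚ.< p) (0<q : 0ℚ ℚ.< q) → p ℚ.≤ q →
                  (ℚ.1/ q) {{ℚ.>-nonZero 0<q}} ℚ.≤ (ℚ.1/ p) {{ℚ.>-nonZero 0<p}}
  1/-antimono-≤ p q 0<p 0<q p≤q = begin
    q⁻¹                        ≡⟨ ℚ.*-identityˡ q⁻¹ ⟨
    1ℚ ℚ.* q⁻¹                 ≡⟨ cong (ℚ._* q⁻¹) (ℚ.*-inverseʳ p {{ℚ.>-nonZero 0<p}}) ⟨
    p ℚ.* p⁻¹ ℚ.* q⁻¹          ≤⟨ ℚ.*-monoʳ-≤-nonNeg q⁻¹ {{nonNeg q 0<q}}
                                    (ℚ.*-monoʳ-≤-nonNeg p⁻¹ {{nonNeg p 0<p}} p≤q) ⟩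
    q ℚ.* p⁻¹ ℚ.* q⁻¹          ≡⟨ solve 3 (λ q r s → q :* r :* s := r :* (q :* s)) refl q p⁻¹ q⁻¹ ⟩
    p⁻¹ ℚ.* (q ℚ.* q⁻¹)        ≡⟨ cong (p⁻¹ ℚ.*_) (ℚ.*-inverseʳ q {{ℚ.>-nonZero 0<q}}) ⟩
    p⁻¹ ℚ.* 1ℚ                 ≡⟨ ℚ.*-identityʳ p⁻¹ ⟩
    p⁻¹                        ∎
    where
    p⁻¹ = (ℚ.1/ p) {{ℚ.>-nonZero 0<p}}
    q⁻¹ = (ℚ.1/ q) {{ℚ.>-nonZero 0<q}}
    nonNeg : ∀ r (0<r : 0ℚ ℚ.< r) → ℚ.NonNegative ((ℚ.1/ r) {{ℚ.>-nonZero 0<r}})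
    nonNeg r 0<r = ℚ.nonNegative (ℚ.<⇒≤ (1/p-pos r 0<r))

  *-close : ∀ a b c d {B C δ} → 0ℚ ℚ.≤ C → 0ℚ ℚ.≤ δ →
            ℚ.∣ a ℚ.- c ∣ ℚ.≤ δ → ℚ.∣ b ∣ ℚ.≤ C → ℚ.∣ c ∣ ℚ.≤ B → ℚ.∣ b ℚ.- d ∣ ℚ.≤ δ →
            ℚ.∣ (a ℚ.* b) ℚ.- (c ℚ.* d) ∣ ℚ.≤ δ ℚ.* C ℚ.+ B ℚ.* δ
  *-close a b c d {B} {C} {δ} 0≤C 0≤δ h₁ h₂ h₃ h₄ = begin
    ℚ.∣ (a ℚ.* b) ℚ.- (c ℚ.* d) ∣
      ≡⟨ cong ℚ.∣_∣ (solve 4 (λ a b c d → a :* b :- c :* d := (a :- c) :* b :+ c :* (b :- d))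
           refl a b c d) ⟩
    ℚ.∣ (a ℚ.- c) ℚ.* b ℚ.+ c ℚ.* (b ℚ.- d) ∣
      ≤⟨ ℚ.∣p+q∣≤∣p∣+∣q∣ ((a ℚ.- c) ℚ.* b) (c ℚ.* (b ℚ.- d)) ⟩
    ℚ.∣ (a ℚ.- c) ℚ.* b ∣ ℚ.+ ℚ.∣ c ℚ.* (b ℚ.- d) ∣
      ≡⟨ cong₂ ℚ._+_ (ℚ.∣p*q∣≡∣p∣*∣q∣ (a ℚ.- c) b) (ℚ.∣p*q∣≡∣p∣*∣q∣ c (b ℚ.- d)) ⟩
    ℚ.∣ a ℚ.- c ∣ ℚ.* ℚ.∣ b ∣ ℚ.+ ℚ.∣ c ∣ ℚ.* ℚ.∣ b ℚ.- d ∣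
      ≤⟨ ℚ.+-mono-≤ (*-mono-≤-nonNeg (ℚ.0≤∣p∣ (a ℚ.- c)) 0≤C h₁ h₂)
                    (*-mono-≤-nonNeg (ℚ.0≤∣p∣ c) 0≤δ h₃ h₄) ⟩
    δ ℚ.* C ℚ.+ B ℚ.* δ ∎

  split-ε : ∀ B C ε → 0ℚ ℚ.< B ℚ.+ C → 0ℚ ℚ.< ε →
            ∃[ δ ] (0ℚ ℚ.< δ × δ ℚ.* C ℚ.+ B ℚ.* δ ≡ ε)
  split-ε B C ε 0<B+C 0<ε =
    ε ℚ.* i , 0<p*q 0<ε (1/p-pos (B ℚ.+ C) 0<B+C) , trans (factor i)
      (trans (cong (ε ℚ.*_) (ℚ.*-inverseʳ (B ℚ.+ C) {{ℚ.>-nonZero 0<B+C}})) (ℚ.*-identityʳ ε))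
    where
    i = (ℚ.1/ (B ℚ.+ C)) {{ℚ.>-nonZero 0<B+C}}
    factor : ∀ i → (ε ℚ.* i) ℚ.* C ℚ.+ B ℚ.* (ε ℚ.* i) ≡ ε ℚ.* ((B ℚ.+ C) ℚ.* i)
    factor i = solve 4 (λ e i B C → (e :* i) :* C :+ B :* (e :* i) := e :* ((B :+ C) :* i))
      refl ε i B C

  ⊔-nonexpansive : ∀ p q r s {ε} → ℚ.∣ p ℚ.- q ∣ ℚ.≤ ε → ℚ.∣ r ℚ.- s ∣ ℚ.≤ ε →
                   ℚ.∣ (p ℚ.⊔ r) ℚ.- (q ℚ.⊔ s) ∣ ℚ.≤ ε
  ⊔-nonexpansive p q r s {ε} h₁ h₂ = ∣p-q∣≤r (p ℚ.⊔ r) (q ℚ.⊔ s)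
    (bound p q r s (∣p-q∣≤r⇒p≤q+r p q h₁) (∣p-q∣≤r⇒p≤q+r r s h₂))
    (bound q p s r (∣p-q∣≤r⇒q≤p+r p q h₁) (∣p-q∣≤r⇒q≤p+r r s h₂))
    where
    bound : ∀ a b c d → a ℚ.≤ b ℚ.+ ε → c ℚ.≤ d ℚ.+ ε → a ℚ.⊔ c ℚ.≤ (b ℚ.⊔ d) ℚ.+ ε
    bound a b c d h₁ h₂ = ℚ.⊔-lub {_} {a} {c}
      (ℚ.≤-trans h₁ (ℚ.+-monoˡ-≤ ε (ℚ.p≤p⊔q b d)))
      (ℚ.≤-trans h₂ (ℚ.+-monoˡ-≤ ε (ℚ.p≤q⊔p b d)))

-- A real is a Cauchy sequence of rationals with no prescribed rate of
-- convergence; two sequences denote the same real when they are related by _≈_.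

record ℝ : Set where
  constructor mkℝ
  field
    seq    : ℕ → ℚ
    cauchy : ∀ ε → 0ℚ ℚ.< ε →
             ∃[ N ] (∀ m n → N ℕ.≤ m → N ℕ.≤ n → ℚ.∣ seq m ℚ.- seq n ∣ ℚ.≤ ε)

open ℝ public

infix 4 _≈_ _<_ _>_

_≈_ : Rel ℝ 0ℓ
x ≈ y = ∀ ε → 0ℚ ℚ.< ε →
        ∃[ N ] (∀ n → N ℕ.≤ n → ℚ.∣ seq x n ℚ.- seq y n ∣ ℚ.≤ ε)

_<_ : Rel ℝ 0ℓ
x < y = ∃[ ε ] (0ℚ ℚ.< ε × ∃[ N ] (∀ n → N ℕ.≤ n → seq x n ℚ.+ ε ℚ.≤ seq y n))

_>_ : Rel ℝ 0ℓ
x > y = y < x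

fromℚ : ℚ → ℝ
fromℚ q = mkℝ (λ _ → q) λ ε 0<ε → 0 , λ _ _ _ _ → ∣p-p∣≤ε q 0<ε

fromℤ : ℤ → ℝ
fromℤ z = fromℚ (z ℚ./ 1)

fromℕ : ℕ → ℝ
fromℕ n = fromℤ (+ n)

infixl 6 _+_ _⊔_
infixl 7 _*_

_+_ : ℝ → ℝ → ℝ
x + y = mkℝ (λ n → seq x n ℚ.+ seq y n) λ ε 0<ε →
  let (M , hM) = cauchy x (½ ℚ.* ε) (0<½*p 0<ε)
      (N , hN) = cauchy y (½ ℚ.* ε) (0<½*p 0<ε)
  in M ℕ.⊔ N , λ m n h₁ h₂ → begin
    ℚ.∣ (seq x m ℚ.+ seq y m) ℚ.- (seq x n ℚ.+ seq y n) ∣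
      ≡⟨ cong ℚ.∣_∣ (solve 4 (λ a b c d → (a :+ b) :- (c :+ d) := (a :- c) :+ (b :- d)) refl
           (seq x m) (seq y m) (seq x n) (seq y n)) ⟩
    ℚ.∣ (seq x m ℚ.- seq x n) ℚ.+ (seq y m ℚ.- seq y n) ∣
      ≤⟨ ℚ.∣p+q∣≤∣p∣+∣q∣ (seq x m ℚ.- seq x n) (seq y m ℚ.- seq y n) ⟩
    ℚ.∣ seq x m ℚ.- seq x n ∣ ℚ.+ ℚ.∣ seq y m ℚ.- seq y n ∣
      ≤⟨ ℚ.+-mono-≤ (hM m n (ℕ.m⊔n≤o⇒m≤o M N h₁) (ℕ.m⊔n≤o⇒m≤o M N h₂))
                    (hN m n (ℕ.m⊔n≤o⇒n≤o M N h₁) (ℕ.m⊔n≤o⇒n≤o M N h₂)) ⟩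
    ½ ℚ.* ε ℚ.+ ½ ℚ.* ε
      ≡⟨ ½*p+½*p≡p ε ⟩
    ε ∎
  where
  open ℚ.≤-Reasoning
  open +-*-Solver using (solve; _:=_; _:+_; _:-_)

_⊔_ : ℝ → ℝ → ℝ
x ⊔ y = mkℝ (λ n → seq x n ℚ.⊔ seq y n) λ ε 0<ε →
  let (M , hM) = cauchy x ε 0<ε
      (N , hN) = cauchy y ε 0<ε
  in M ℕ.⊔ N , λ m n h₁ h₂ → ⊔-nonexpansive (seq x m) (seq x n) (seq y m) (seq y n)
       (hM m n (ℕ.m⊔n≤o⇒m≤o M N h₁) (ℕ.m⊔n≤o⇒m≤o M N h₂))
       (hN m n (ℕ.m⊔n≤o⇒n≤o M N h₁) (ℕ.m⊔n≤o⇒n≤o M N h₂))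

eventually-bounded : ∀ x → ∃[ B ] (0ℚ ℚ.< B × ∃[ N ] (∀ n → N ℕ.≤ n → ℚ.∣ seq x n ∣ ℚ.≤ B))
eventually-bounded x =
  let (N , hN) = cauchy x 1ℚ (ℚ.positive⁻¹ 1ℚ)
  in ℚ.∣ seq x N ∣ ℚ.+ 1ℚ
   , ℚ.+-mono-≤-< (ℚ.0≤∣p∣ (seq x N)) (ℚ.positive⁻¹ 1ℚ)
   , N
   , λ n N≤n → begin
       ℚ.∣ seq x n ∣
         ≡⟨ cong ℚ.∣_∣ (solve 2 (λ a b → a := b :+ (a :- b)) refl (seq x n) (seq x N)) ⟩
       ℚ.∣ seq x N ℚ.+ (seq x n ℚ.- seq x N) ∣
         ≤⟨ ℚ.∣p+q∣≤∣p∣+∣q∣ (seq x N) (seq x n ℚ.- seq x N) ⟩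
       ℚ.∣ seq x N ∣ ℚ.+ ℚ.∣ seq x n ℚ.- seq x N ∣
         ≤⟨ ℚ.+-monoʳ-≤ ℚ.∣ seq x N ∣ (hN n N N≤n ℕ.≤-refl) ⟩
       ℚ.∣ seq x N ∣ ℚ.+ 1ℚ ∎
  where
  open ℚ.≤-Reasoning
  open +-*-Solver using (solve; _:=_; _:+_; _:-_)

*-cauchy : ∀ x y ε → 0ℚ ℚ.< ε → ∃[ N ] (∀ m n → N ℕ.≤ m → N ℕ.≤ n →
           ℚ.∣ (seq x m ℚ.* seq y m) ℚ.- (seq x n ℚ.* seq y n) ∣ ℚ.≤ ε)
*-cauchy x y ε 0<ε =
  let (B , 0<B , K , hK) = eventually-bounded x
      (C , 0<C , L , hL) = eventually-bounded y
      (δ , 0<δ , split) = split-ε B C ε (ℚ.+-mono-< 0<B 0<C) 0<ε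
      (M , hM) = cauchy x δ 0<δ
      (N , hN) = cauchy y δ 0<δ
      ≤₁ : ∀ {k} → (K ℕ.⊔ L) ℕ.⊔ (M ℕ.⊔ N) ℕ.≤ k → K ℕ.⊔ L ℕ.≤ k
      ≤₁ = ℕ.m⊔n≤o⇒m≤o (K ℕ.⊔ L) (M ℕ.⊔ N)
      ≤₂ : ∀ {k} → (K ℕ.⊔ L) ℕ.⊔ (M ℕ.⊔ N) ℕ.≤ k → M ℕ.⊔ N ℕ.≤ k
      ≤₂ = ℕ.m⊔n≤o⇒n≤o (K ℕ.⊔ L) (M ℕ.⊔ N)
  in (K ℕ.⊔ L) ℕ.⊔ (M ℕ.⊔ N) , λ m n h₁ h₂ → ℚ.≤-trans
    (*-close (seq x m) (seq y m) (seq x n) (seq y n) (ℚ.<⇒≤ 0<C) (ℚ.<⇒≤ 0<δ)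
      (hM m n (ℕ.m⊔n≤o⇒m≤o M N (≤₂ h₁)) (ℕ.m⊔n≤o⇒m≤o M N (≤₂ h₂)))
      (hL m (ℕ.m⊔n≤o⇒n≤o K L (≤₁ h₁)))
      (hK n (ℕ.m⊔n≤o⇒m≤o K L (≤₁ h₂)))
      (hN m n (ℕ.m⊔n≤o⇒n≤o M N (≤₂ h₁)) (ℕ.m⊔n≤o⇒n≤o M N (≤₂ h₂))))
    (ℚ.≤-reflexive split)

_*_ : ℝ → ℝ → ℝ
x * y = mkℝ (λ n → seq x n ℚ.* seq y n) (*-cauchy x y)

ℝ-rawSemiring : RawSemiring 0ℓ 0ℓ
ℝ-rawSemiring = record
  { _≈_ = _≈_
  ; _+_ = _+_
  ; _*_ = _*_
  ; 0#  = fromℚ 0ℚ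
  ; 1#  = fromℚ 1ℚ
  }

-- The proof of 0 < y gives ε > 0 with ε ≤ seq y n for all large n, so replacing
-- seq y n by its maximum with ε before inverting changes only finitely many terms.

module Inverse (y : ℝ) (0<y : fromℚ 0ℚ < y) where

  ε   = proj₁ 0<y
  0<ε = proj₁ (proj₂ 0<y)
  ε⁻¹ = (ℚ.1/ ε) {{ℚ.>-nonZero 0<ε}}

  clamp : ℕ → ℚ
  clamp n = seq y n ℚ.⊔ ε

  0<clamp : ∀ n → 0ℚ ℚ.< clamp n
  0<clamp n = ℚ.<-≤-trans 0<ε (ℚ.p≤q⊔p (seq y n) ε)

  inverse-seq : ℕ → ℚ
  inverse-seq n = (ℚ.1/ clamp n) {{ℚ.>-nonZero (0<clamp n)}}

  inverse-cauchy : ∀ δ → 0ℚ ℚ.< δ → ∃[ N ] (∀ m n → N ℕ.≤ m → N ℕ.≤ n →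
                   ℚ.∣ inverse-seq m ℚ.- inverse-seq n ∣ ℚ.≤ δ)
  inverse-cauchy δ 0<δ with cauchy y (δ ℚ.* (ε ℚ.* ε)) (0<p*q 0<δ (0<p*q 0<ε 0<ε))
  ... | N , hN = N , bound
    where
    open ℚ.≤-Reasoning
    open +-*-Solver using (solve; _:=_; _:*_; _:-_; :-_)
    module _ (n : ℕ) where
      ≤ε⁻¹ : inverse-seq n ℚ.≤ ε⁻¹
      ≤ε⁻¹ = 1/-antimono-≤ ε (clamp n) 0<ε (0<clamp n) (ℚ.p≤q⊔p (seq y n) ε)
      ≥0 : 0ℚ ℚ.≤ inverse-seq n
      ≥0 = ℚ.<⇒≤ (1/p-pos (clamp n) (0<clamp n))
      inv : clamp n ℚ.* inverse-seq n ≡ 1ℚ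
      inv = ℚ.*-inverseʳ (clamp n) {{ℚ.>-nonZero (0<clamp n)}}
    invε : ε ℚ.* ε⁻¹ ≡ 1ℚ
    invε = ℚ.*-inverseʳ ε {{ℚ.>-nonZero 0<ε}}
    bound : ∀ m n → N ℕ.≤ m → N ℕ.≤ n → ℚ.∣ inverse-seq m ℚ.- inverse-seq n ∣ ℚ.≤ δ
    bound m n h₁ h₂ = begin
      ℚ.∣ i ℚ.- j ∣
        ≡⟨ cong ℚ.∣_∣ (cong₂ ℚ._-_ (ℚ.*-identityʳ i) (ℚ.*-identityʳ j)) ⟨
      ℚ.∣ i ℚ.* 1ℚ ℚ.- j ℚ.* 1ℚ ∣
        ≡⟨ cong ℚ.∣_∣ (cong₂ (λ s t → i ℚ.* s ℚ.- j ℚ.* t) (inv n) (inv m)) ⟨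
      ℚ.∣ i ℚ.* (clamp n ℚ.* j) ℚ.- j ℚ.* (clamp m ℚ.* i) ∣
        ≡⟨ cong ℚ.∣_∣ (solve 4 (λ i j a b → i :* (b :* j) :- j :* (a :* i)
                                         := :- ((a :- b) :* (i :* j)))
             refl i j (clamp m) (clamp n)) ⟩
      ℚ.∣ ℚ.- ((clamp m ℚ.- clamp n) ℚ.* (i ℚ.* j)) ∣
        ≡⟨ ℚ.∣-p∣≡∣p∣ ((clamp m ℚ.- clamp n) ℚ.* (i ℚ.* j)) ⟩
      ℚ.∣ (clamp m ℚ.- clamp n) ℚ.* (i ℚ.* j) ∣
        ≡⟨ ℚ.∣p*q∣≡∣p∣*∣q∣ (clamp m ℚ.- clamp n) (i ℚ.* j) ⟩
      ℚ.∣ clamp m ℚ.- clamp n ∣ ℚ.* ℚ.∣ i ℚ.* j ∣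
        ≡⟨ cong (ℚ.∣ clamp m ℚ.- clamp n ∣ ℚ.*_) (ℚ.0≤p⇒∣p∣≡p (0≤p*q (≥0 m) (≥0 n))) ⟩
      ℚ.∣ clamp m ℚ.- clamp n ∣ ℚ.* (i ℚ.* j)
        ≤⟨ *-mono-≤-nonNeg (ℚ.0≤∣p∣ (clamp m ℚ.- clamp n)) (0≤p*q 0≤ε⁻¹ 0≤ε⁻¹)
             (⊔-nonexpansive (seq y m) (seq y n) ε ε (hN m n h₁ h₂)
               (∣p-p∣≤ε ε (0<p*q 0<δ (0<p*q 0<ε 0<ε))))
             (*-mono-≤-nonNeg (≥0 m) 0≤ε⁻¹ (≤ε⁻¹ m) (≤ε⁻¹ n)) ⟩
      δ ℚ.* (ε ℚ.* ε) ℚ.* (ε⁻¹ ℚ.* ε⁻¹)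
        ≡⟨ solve 3 (λ d e i → d :* (e :* e) :* (i :* i) := d :* ((e :* i) :* (e :* i)))
             refl δ ε ε⁻¹ ⟩
      δ ℚ.* ((ε ℚ.* ε⁻¹) ℚ.* (ε ℚ.* ε⁻¹))
        ≡⟨ cong (λ t → δ ℚ.* (t ℚ.* t)) invε ⟩
      δ ℚ.* 1ℚ
        ≡⟨ ℚ.*-identityʳ δ ⟩
      δ ∎
      where
      i = inverse-seq m
      j = inverse-seq n
      0≤ε⁻¹ : 0ℚ ℚ.≤ ε⁻¹
      0≤ε⁻¹ = ℚ.<⇒≤ (1/p-pos ε 0<ε)

inverse : (y : ℝ) → fromℚ 0ℚ < y → ℝ
inverse y 0<y = mkℝ (Inverse.inverse-seq y 0<y) (Inverse.inverse-cauchy y 0<y)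

infixl 7 _/_[_]

_/_[_] : (x y : ℝ) → fromℚ 0ℚ < y → ℝ
x / y [ 0<y ] = x * inverse y 0<y

-- The largest k ≤ b satisfying a decidable predicate (0 if there is none).

largest : {P : Pred ℕ 0ℓ} → (∀ k → Dec (P k)) → ℕ → ℕ
largest P? zero    = zero
largest P? (suc b) = if does (P? (suc b)) then suc b else largest P? b

module _ {P : Pred ℕ 0ℓ} (P? : ∀ k → Dec (P k)) where

  largest-satisfies : P 0 → ∀ b → P (largest P? b)
  largest-satisfies P0 zero = P0
  largest-satisfies P0 (suc b) with P? (suc b)
  ... | yes p = p
  ... | no  _ = largest-satisfies P0 b

  largest-maximal : ∀ b → ¬ P (suc b) → ¬ P (suc (largest P? b))
  largest-maximal zero ¬p = ¬p
  largest-maximal (suc b) ¬p with P? (suc b)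
  ... | yes _  = ¬p
  ... | no ¬p′ = largest-maximal b ¬p′

grid : ℕ → ℕ → ℚ
grid n k = + k ℚ./ suc n

grid-suc : ∀ n k → grid n (suc k) ≡ grid n k ℚ.+ grid n 1
grid-suc n k = ℚ.toℚᵘ-injective (begin
  ℚ.toℚᵘ (grid n (suc k))                       ≈⟨ ℚ.toℚᵘ-fromℚᵘ (ℚᵘ.mkℚᵘ (+ suc k) n) ⟩
  ℚᵘ.mkℚᵘ (+ suc k) n                           ≈⟨ ℚᵘ.*≡* (eq (+ k) (+ suc n)) ⟩
  ℚᵘ.mkℚᵘ (+ k) n ℚᵘ.+ ℚᵘ.mkℚᵘ (+ 1) n          ≈⟨ ℚᵘ.+-cong (ℚ.toℚᵘ-fromℚᵘ (ℚᵘ.mkℚᵘ (+ k) n))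
                                                             (ℚ.toℚᵘ-fromℚᵘ (ℚᵘ.mkℚᵘ (+ 1) n)) ⟨
  ℚ.toℚᵘ (grid n k) ℚᵘ.+ ℚ.toℚᵘ (grid n 1)      ≈⟨ ℚ.toℚᵘ-homo-+ (grid n k) (grid n 1) ⟨
  ℚ.toℚᵘ (grid n k ℚ.+ grid n 1)                ∎)
  where
  open ℚᵘ.≃-Reasoning
  eq : ∀ k s → (+ 1 ℤ.+ k) ℤ.* (s ℤ.* s) ≡ (k ℤ.* s ℤ.+ + 1 ℤ.* s) ℤ.* s
  eq = ℤSolver.solve-∀

0≤grid : ∀ n k → 0ℚ ℚ.≤ grid n k
0≤grid n k = ℚ.nonNegative⁻¹ (grid n k) {{ℚ.normalize-nonNeg k (suc n)}}

-- q ≤ ∣ ↥ q ∣ < (1 + ∣ ↥ q ∣)², so every k with (k/(n+1))² ≤ q is below this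
-- bound.
search-bound : ℕ → ℚ → ℕ
search-bound n q = suc ℤ.∣ ℚ.↥ q ∣ ℕ.* suc n

Square≤ : ℕ → ℚ → Pred ℕ 0ℓ
Square≤ n q k = grid n k ℚ.* grid n k ℚ.≤ q

square≤? : ∀ n q k → Dec (Square≤ n q k)
square≤? n q k = grid n k ℚ.* grid n k ℚ.≤? q

√ℚ-numerator : ℕ → ℚ → ℕ
√ℚ-numerator n q = largest (square≤? n q) (search-bound n q)

-- The largest multiple of 1/(n+1) whose square is at most q.
√ℚ : ℕ → ℚ → ℚ
√ℚ n q = grid n (√ℚ-numerator n q)

0≤√ℚ : ∀ n q → 0ℚ ℚ.≤ √ℚ n q
0≤√ℚ n q = 0≤grid n (√ℚ-numerator n q)

√ℚ²≤ : ∀ n {q} → 0ℚ ℚ.≤ q → √ℚ n q ℚ.* √ℚ n q ℚ.≤ q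
√ℚ²≤ n {q} 0≤q = largest-satisfies {P = Square≤ n q} (square≤? n q)
  (subst (λ t → t ℚ.* t ℚ.≤ q) (sym (ℚ.0/n≡0 (suc n))) 0≤q) (search-bound n q)

<√ℚ+² : ∀ n q → q ℚ.< (√ℚ n q ℚ.+ grid n 1) ℚ.* (√ℚ n q ℚ.+ grid n 1)
<√ℚ+² n q = subst (λ t → q ℚ.< t ℚ.* t) (grid-suc n (√ℚ-numerator n q))
  (ℚ.≰⇒> (largest-maximal {P = Square≤ n q} (square≤? n q) (search-bound n q)
    λ g²≤q → ℚ.<-irrefl refl (ℚ.<-≤-trans exceeds g²≤q)))
  where
  open ℚ.≤-Reasoning
  a = ℤ.∣ ℚ.↥ q ∣
  g = grid n (suc (search-bound n q))
  c = grid 0 (suc a)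
  q≤a : q ℚ.≤ grid 0 a
  q≤a = ℚ.toℚᵘ-cancel-≤ (ℚᵘ.≤-respʳ-≃ (ℚᵘ.≃-sym (ℚ.toℚᵘ-fromℚᵘ (ℚᵘ.mkℚᵘ (+ a) 0)))
          (num q))
    where
    num : ∀ q → ℚ.toℚᵘ q ℚᵘ.≤ ℚᵘ.mkℚᵘ (+ ℤ.∣ ℚ.↥ q ∣) 0
    num (ℚ.mkℚ (+ k) e _) = ℚᵘ.*≤* (subst (ℤ._≤ + k ℤ.* + suc e) (refl {x = + k ℤ.* + 1})
      (ℤ.*-monoˡ-≤-nonNeg (+ k) (ℤ.+≤+ (s≤s z≤n))))
    num (ℚ.mkℚ ℤ.-[1+ k ] e _) = ℚᵘ.*≤* ℤ.-≤+
  a<c : grid 0 a ℚ.< c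
  a<c = begin-strict
    grid 0 a            ≡⟨ ℚ.+-identityʳ (grid 0 a) ⟨
    grid 0 a ℚ.+ 0ℚ     <⟨ ℚ.+-monoʳ-< (grid 0 a) (ℚ.positive⁻¹ 1ℚ) ⟩
    grid 0 a ℚ.+ 1ℚ     ≡⟨ grid-suc 0 a ⟨
    c                   ∎
  c≥1 : 1ℚ ℚ.≤ c
  c≥1 = begin
    1ℚ                  ≡⟨ ℚ.+-identityˡ 1ℚ ⟨
    0ℚ ℚ.+ 1ℚ           ≤⟨ ℚ.+-monoˡ-≤ 1ℚ (0≤grid 0 a) ⟩
    grid 0 a ℚ.+ 1ℚ     ≡⟨ grid-suc 0 a ⟨
    c                   ∎
  c≤g : c ℚ.≤ g
  c≤g = begin
    c                                             ≡⟨ ℚ.toℚᵘ-injective same ⟩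
    grid n (search-bound n q)                     ≡⟨ ℚ.+-identityʳ _ ⟨
    grid n (search-bound n q) ℚ.+ 0ℚ              ≤⟨ ℚ.+-monoʳ-≤ (grid n (search-bound n q)) (0≤grid n 1) ⟩
    grid n (search-bound n q) ℚ.+ grid n 1        ≡⟨ grid-suc n (search-bound n q) ⟨
    g                                             ∎
    where
    same : ℚ.toℚᵘ c ℚᵘ.≃ ℚ.toℚᵘ (grid n (search-bound n q))
    same = ℚᵘ.≃-trans (ℚ.toℚᵘ-fromℚᵘ (ℚᵘ.mkℚᵘ (+ suc a) 0))
      (ℚᵘ.≃-trans (ℚᵘ.*≡* (sym (trans (ℤ.*-identityʳ _) (ℤ.pos-* (suc a) (suc n)))))
      (ℚᵘ.≃-sym (ℚ.toℚᵘ-fromℚᵘ (ℚᵘ.mkℚᵘ (+ search-bound n q) n))))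
  exceeds : q ℚ.< g ℚ.* g
  exceeds = begin-strict
    q            ≤⟨ q≤a ⟩
    grid 0 a     <⟨ a<c ⟩
    c            ≡⟨ ℚ.*-identityʳ c ⟨
    c ℚ.* 1ℚ     ≤⟨ *-mono-≤-nonNeg (0≤grid 0 (suc a)) (0≤grid n (suc (search-bound n q))) c≤g (ℚ.≤-trans c≥1 c≤g) ⟩
    g ℚ.* g      ∎

grid-archimedean : ∀ ε → 0ℚ ℚ.< ε → ∃[ N ] (∀ n → N ℕ.≤ n → grid n 1 ℚ.≤ ε)
grid-archimedean (ℚ.mkℚ (+ zero) e c) 0<ε = contradiction (ℚ.positive 0<ε) λ ()
grid-archimedean (ℚ.mkℚ (ℤ.-[1+ k ]) e c) 0<ε = contradiction (ℚ.positive 0<ε) λ ()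
grid-archimedean (ℚ.mkℚ (+ suc k) e c) 0<ε = e , λ n e≤n →
  ℚ.toℚᵘ-cancel-≤ (ℚᵘ.≤-respˡ-≃ (ℚᵘ.≃-sym (ℚ.toℚᵘ-fromℚᵘ (ℚᵘ.mkℚᵘ (+ 1) n)))
    (ℚᵘ.*≤* (begin
      + 1 ℤ.* + suc e       ≡⟨ ℤ.*-identityˡ (+ suc e) ⟩
      + suc e               ≤⟨ ℤ.+≤+ (ℕ.≤-trans (s≤s e≤n) (ℕ.m≤n*m (suc n) (suc k))) ⟩
      + (suc k ℕ.* suc n)   ≡⟨ ℤ.pos-* (suc k) (suc n) ⟩
      + suc k ℤ.* + suc n   ∎)))
  where open ℤ.≤-Reasoning

√ℚ-close : ∀ m n u v h → 0ℚ ℚ.≤ u → 0ℚ ℚ.< h → grid n 1 ℚ.≤ h →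
           u ℚ.≤ v ℚ.+ h ℚ.* h → √ℚ m u ℚ.≤ √ℚ n v ℚ.+ (h ℚ.+ h)
√ℚ-close m n u v h 0≤u 0<h 1/n≤h u≤v+h² = ℚ.≮⇒≥ λ s+2h<r → ℚ.<-irrefl refl
  (ℚ.<-≤-trans (u<[s+2h]² (√ℚ n v) (0≤√ℚ n v) (<√ℚ+² n v))
    (ℚ.≤-trans (p≤q⇒p²≤q² (ℚ.+-mono-≤ (0≤√ℚ n v) (ℚ.+-mono-≤ 0≤h 0≤h)) (ℚ.<⇒≤ s+2h<r))
      (√ℚ²≤ m 0≤u)))
  where
  open ℚ.≤-Reasoning
  open +-*-Solver using (solve; _:=_; _:+_; _:*_)
  0≤h = ℚ.<⇒≤ 0<h
  u<[s+2h]² : ∀ s → 0ℚ ℚ.≤ s → v ℚ.< (s ℚ.+ grid n 1) ℚ.* (s ℚ.+ grid n 1) →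
              u ℚ.< (s ℚ.+ (h ℚ.+ h)) ℚ.* (s ℚ.+ (h ℚ.+ h))
  u<[s+2h]² s 0≤s v< = begin-strict
    u
      ≤⟨ u≤v+h² ⟩
    v ℚ.+ h ℚ.* h
      <⟨ ℚ.+-monoˡ-< (h ℚ.* h) v< ⟩
    (s ℚ.+ grid n 1) ℚ.* (s ℚ.+ grid n 1) ℚ.+ h ℚ.* h
      ≤⟨ ℚ.+-monoˡ-≤ (h ℚ.* h) (p≤q⇒p²≤q² (ℚ.+-mono-≤ 0≤s (0≤grid n 1)) (ℚ.+-monoʳ-≤ s 1/n≤h)) ⟩
    (s ℚ.+ h) ℚ.* (s ℚ.+ h) ℚ.+ h ℚ.* h
      ≡⟨ ℚ.+-identityʳ _ ⟨
    (s ℚ.+ h) ℚ.* (s ℚ.+ h) ℚ.+ h ℚ.* h ℚ.+ 0ℚ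
      ≤⟨ ℚ.+-monoʳ-≤ ((s ℚ.+ h) ℚ.* (s ℚ.+ h) ℚ.+ h ℚ.* h) 0≤cross ⟩
    (s ℚ.+ h) ℚ.* (s ℚ.+ h) ℚ.+ h ℚ.* h ℚ.+ (h ℚ.* (s ℚ.+ h) ℚ.+ h ℚ.* (s ℚ.+ h))
      ≡⟨ solve 2 (λ s h → (s :+ h) :* (s :+ h) :+ h :* h :+ (h :* (s :+ h) :+ h :* (s :+ h))
                       := (s :+ (h :+ h)) :* (s :+ (h :+ h))) refl s h ⟩
    (s ℚ.+ (h ℚ.+ h)) ℚ.* (s ℚ.+ (h ℚ.+ h)) ∎
    where
    0≤cross : 0ℚ ℚ.≤ h ℚ.* (s ℚ.+ h) ℚ.+ h ℚ.* (s ℚ.+ h)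
    0≤cross = ℚ.+-mono-≤ (0≤p*q 0≤h (ℚ.+-mono-≤ 0≤s 0≤h)) (0≤p*q 0≤h (ℚ.+-mono-≤ 0≤s 0≤h))

halve : ∀ ε → 0ℚ ℚ.< ε → ∃[ h ] (0ℚ ℚ.< h × h ℚ.+ h ≡ ε)
halve ε 0<ε = ½ ℚ.* ε , 0<½*p 0<ε , ½*p+½*p≡p ε

√-cauchy : ∀ x ε → 0ℚ ℚ.< ε → ∃[ N ] (∀ m n → N ℕ.≤ m → N ℕ.≤ n →
           ℚ.∣ √ℚ m (seq x m ℚ.⊔ 0ℚ) ℚ.- √ℚ n (seq x n ℚ.⊔ 0ℚ) ∣ ℚ.≤ ε)
√-cauchy x ε 0<ε =
  let (h , 0<h , h+h≡ε) = halve ε 0<ε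
      (M , hM) = cauchy x (h ℚ.* h) (0<p*q 0<h 0<h)
      (K , hK) = grid-archimedean h 0<h
      close : ∀ m n → M ℕ.⊔ K ℕ.≤ m → M ℕ.⊔ K ℕ.≤ n →
              √ℚ m (seq x m ℚ.⊔ 0ℚ) ℚ.≤ √ℚ n (seq x n ℚ.⊔ 0ℚ) ℚ.+ ε
      close = λ m n h₁ h₂ → subst (λ t → √ℚ m (seq x m ℚ.⊔ 0ℚ) ℚ.≤ √ℚ n (seq x n ℚ.⊔ 0ℚ) ℚ.+ t) h+h≡ε
        (√ℚ-close m n (seq x m ℚ.⊔ 0ℚ) (seq x n ℚ.⊔ 0ℚ) h
          (ℚ.p≤q⊔p (seq x m) 0ℚ) 0<h (hK n (ℕ.m⊔n≤o⇒n≤o M K h₂))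
          (∣p-q∣≤r⇒p≤q+r (seq x m ℚ.⊔ 0ℚ) (seq x n ℚ.⊔ 0ℚ) (⊔-nonexpansive (seq x m) (seq x n) 0ℚ 0ℚ
            (hM m n (ℕ.m⊔n≤o⇒m≤o M K h₁) (ℕ.m⊔n≤o⇒m≤o M K h₂))
            (∣p-p∣≤ε 0ℚ (0<p*q 0<h 0<h)))))
  in M ℕ.⊔ K , λ m n h₁ h₂ →
    ∣p-q∣≤r (√ℚ m (seq x m ℚ.⊔ 0ℚ)) (√ℚ n (seq x n ℚ.⊔ 0ℚ)) (close m n h₁ h₂) (close n m h₂ h₁)

infix 9 √_

-- Negative reals are sent to 0.
√_ : ℝ → ℝ
√ x = mkℝ (λ n → √ℚ n (seq x n ℚ.⊔ 0ℚ)) (√-cauchy x)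

0<fromℕ : ∀ n → 0 ℕ.< n → fromℚ 0ℚ < fromℕ n
0<fromℕ (suc n) _ = 1ℚ , ℚ.positive⁻¹ 1ℚ , 0 , λ _ _ →
  subst (0ℚ ℚ.+ 1ℚ ℚ.≤_) (sym (grid-suc 0 n)) (ℚ.+-monoˡ-≤ 1ℚ (0≤grid 0 n))

0<*  : ∀ x y → fromℚ 0ℚ < x → fromℚ 0ℚ < y → fromℚ 0ℚ < x * y
0<* x y (δ , 0<δ , M , hM) (ε , 0<ε , N , hN) =
  δ ℚ.* ε , 0<p*q 0<δ 0<ε , M ℕ.⊔ N , λ n h →
    let δ≤ = subst (ℚ._≤ seq x n) (ℚ.+-identityˡ δ) (hM n (ℕ.m⊔n≤o⇒m≤o M N h))
        ε≤ = subst (ℚ._≤ seq y n) (ℚ.+-identityˡ ε) (hN n (ℕ.m⊔n≤o⇒n≤o M N h))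
    in subst (ℚ._≤ seq x n ℚ.* seq y n) (sym (ℚ.+-identityˡ (δ ℚ.* ε)))
         (*-mono-≤-nonNeg (ℚ.<⇒≤ 0<δ) (ℚ.≤-trans (ℚ.<⇒≤ 0<ε) ε≤) δ≤ ε≤)

below-ε : ∀ ε → 0ℚ ℚ.< ε → ∃[ h ] (0ℚ ℚ.< h × (h ℚ.+ h) ℚ.* (h ℚ.+ h) ℚ.≤ ε)
below-ε ε 0<ε =
  let (h , 0<h , h+h≡δ) = halve (ε ℚ.⊓ 1ℚ) 0<δ
  in h , 0<h , subst (λ t → t ℚ.* t ℚ.≤ ε) (sym h+h≡δ) (ℚ.≤-trans
       (*-mono-≤-nonNeg (ℚ.<⇒≤ 0<δ) (ℚ.<⇒≤ (ℚ.positive⁻¹ 1ℚ)) (ℚ.p⊓q≤p ε 1ℚ) (ℚ.p⊓q≤q ε 1ℚ))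
       (ℚ.≤-reflexive (ℚ.*-identityʳ ε)))
  where
  0<δ : 0ℚ ℚ.< ε ℚ.⊓ 1ℚ
  0<δ with ℚ.⊓-sel ε 1ℚ
  ... | inj₁ eq = subst (0ℚ ℚ.<_) (sym eq) 0<ε
  ... | inj₂ eq = subst (0ℚ ℚ.<_) (sym eq) (ℚ.positive⁻¹ 1ℚ)

0<√ : ∀ x → fromℚ 0ℚ < x → fromℚ 0ℚ < √ x
0<√ x (ε , 0<ε , M , hM) =
  let (h , 0<h , 4h²≤ε) = below-ε ε 0<ε
      (K , hK) = grid-archimedean h 0<h
  in h , 0<h , M ℕ.⊔ K , λ n M⊔K≤n → subst (ℚ._≤ seq (√ x) n) (sym (ℚ.+-identityˡ h))
    (ℚ.≮⇒≥ λ s<h → ℚ.<-irrefl refl (begin-strict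
      ε
        ≡⟨ ℚ.+-identityˡ ε ⟨
      0ℚ ℚ.+ ε
        ≤⟨ hM n (ℕ.m⊔n≤o⇒m≤o M K M⊔K≤n) ⟩
      seq x n
        ≤⟨ ℚ.p≤p⊔q (seq x n) 0ℚ ⟩
      seq x n ℚ.⊔ 0ℚ
        <⟨ <√ℚ+² n (seq x n ℚ.⊔ 0ℚ) ⟩
      (seq (√ x) n ℚ.+ grid n 1) ℚ.* (seq (√ x) n ℚ.+ grid n 1)
        ≤⟨ p≤q⇒p²≤q² (ℚ.+-mono-≤ (0≤√ℚ n (seq x n ℚ.⊔ 0ℚ)) (0≤grid n 1))
             (ℚ.+-mono-≤ (ℚ.<⇒≤ s<h) (hK n (ℕ.m⊔n≤o⇒n≤o M K M⊔K≤n))) ⟩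
      (h ℚ.+ h) ℚ.* (h ℚ.+ h)
        ≤⟨ 4h²≤ε ⟩
      ε ∎))
  where open ℚ.≤-Reasoning

0<20√ : ∀ {d} → 2 ℕ.≤ d → fromℚ 0ℚ < fromℕ 20 * √ fromℕ d
0<20√ {d} 2≤d = 0<* (fromℕ 20) (√ fromℕ d) (0<fromℕ 20 (s≤s z≤n))
  (0<√ (fromℕ d) (0<fromℕ d (ℕ.≤-trans (s≤s z≤n) 2≤d)))

open SemiringDefinitions ℝ-rawSemiring public using (_^_)

module LinearCombination (R : RawSemiring 0ℓ 0ℓ) where
  open RawSemiring R renaming (_≈_ to _≈ᴿ_; _*_ to _*ᴿ_)
  open SemiringDefinitions R using (sum)

  combination : ∀ {d n} → Vector Carrier n → Vector (Vector Carrier d) n → Vector Carrier d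
  combination c v i = sum (λ j → c j *ᴿ v j i)

  infix 4 _≋_
  _≋_ : ∀ {d} → Rel (Vector Carrier d) 0ℓ
  _≋_ = Pointwise _≈ᴿ_

open LinearCombination ℤ.+-*-rawSemiring public
  renaming (combination to combinationℤ; _≋_ to _≋ℤ_)
open LinearCombination ℝ-rawSemiring public
  renaming (combination to combinationℝ; _≋_ to _≋ℝ_)

𝓛 : ∀ {d n} → Vector (Vector ℤ d) n → Pred (Vector ℤ d) 0ℓ
𝓛 a b = ∃[ c ] (b ≋ℤ combinationℤ c a)

toℝ : ∀ {d} → Vector ℤ d → Vector ℝ d
toℝ = map fromℤ

‖_‖ : ∀ {d} → Vector ℝ d → ℝ
‖ v ‖ = √ sum (λ i → v i ^ 2)
  where open SemiringDefinitions ℝ-rawSemiring using (sum)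

maximum : ∀ {n} → Vector ℝ (suc n) → ℝ
maximum v = foldr _⊔_ (head v) (tail v)

-- Indexed by row first, then by column.
Matrix : Set → ℕ → ℕ → Set
Matrix C m n = Vector (Vector C n) m

columns : ∀ {C m n} → Matrix C m n → Vector (Vector C m) n
columns A j i = A i j

{-# OPTIONS --safe #-}

-- Let n = 2d and N = n^d.  Take the columns n e_i - e_{i+1} for 1 ≤ i < d together
-- with u = n e_d - e_1 and v = n e_d.  The functional φ with weights 1, n, …, n^{d-1}
-- kills all columns but φ(u) = N - 1 and φ(v) = N, and an element b of the lattice
-- whose φ-value is the Frobenius number N(N - 1) - N - (N - 1) has no non-negative
-- integer representation.  The columns satisfy an integer relation with coefficients
-- -N at u and N - 1 at v, so moving an integer representation of b along half of that
-- relation makes every coefficient at least (N - 3)/2.  The columns have norm at most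
-- n + 1, and (n + 1)^d ≤ 2N by Bernoulli's inequality, so this beats the threshold.

module Submission where

import Algebra.Definitions.RawSemiring as SemiringDefinitions
open import Data.Fin.Base as Fin using (Fin; zero; suc; inject₁)
open import Data.Integer.Base using (ℤ; 0ℤ; _≤_)
import Data.Integer.Base as ℤ
import Data.Integer.Properties as ℤ
open import Data.Integer.Solver using (module +-*-Solver)
open import Data.Nat.Base as ℕ using (ℕ; zero; suc)
import Data.Nat.Properties as ℕ
open import Data.Product.Base using (_×_; Σ-syntax; _,_; proj₂)
open import Data.Rational.Base as ℚ using (ℚ; 0ℚ; 1ℚ; ½)
import Data.Rational.Properties as ℚ
import Data.Rational.Unnormalised.Base as ℚᵘ
import Data.Rational.Unnormalised.Properties as ℚᵘ
open import Data.Vec.Functional using (Vector; foldr; tail)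
open import Relation.Binary.PropositionalEquality
open import Relation.Nullary using (¬_)
open import Relation.Unary using (_∈_)
open import Defs

-- The two-generator Frobenius number

0≤i*j : ∀ {i j} → 0ℤ ≤ i → 0ℤ ≤ j → 0ℤ ≤ i ℤ.* j
0≤i*j {i} {j} 0≤i 0≤j = subst (_≤ i ℤ.* j) (ℤ.*-zeroʳ i) (ℤ.*-monoˡ-≤-nonNeg i {{ℤ.nonNegative 0≤i}} 0≤j)

e-last : ∀ {d} → Vector ℤ (suc d)
e-last {zero}  zero    = ℤ.1ℤ
e-last {suc d} zero    = 0ℤ
e-last {suc d} (suc i) = e-last i

e-last-inject₁ : ∀ {d} (i : Fin d) → e-last (inject₁ i) ≡ 0ℤ
e-last-inject₁ zero    = refl
e-last-inject₁ (suc i) = e-last-inject₁ i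

e-last-fromℕ : ∀ d → e-last (Fin.fromℕ d) ≡ ℤ.1ℤ
e-last-fromℕ zero    = refl
e-last-fromℕ (suc d) = e-last-fromℕ d

-- The right-hand side is the Frobenius number N(N - 1) - N - (N - 1).
frobenius : ∀ {N} x y → 0ℤ ℤ.< N → 0ℤ ≤ x → 0ℤ ≤ y →
            N ℤ.* x ℤ.+ (N ℤ.- ℤ.1ℤ) ℤ.* y ≢ N ℤ.* ℤ.-1ℤ ℤ.+ (N ℤ.- ℤ.1ℤ) ℤ.* (N ℤ.- ℤ.1ℤ)
frobenius {N} x y 0<N 0≤x 0≤y eq = ℤ.<-irrefl (sym excess≡0)
  (ℤ.+-mono-<-≤ (ℤ.+-mono-<-≤ 0<N (0≤i*j (ℤ.<⇒≤ 0<N) 0≤x)) (0≤i*j (ℤ.i≤j⇒0≤j-i 1≤N) (ℤ.i≤j⇒0≤j-i N≤y+1)))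
  where
  open +-*-Solver
  open ℤ.≤-Reasoning
  -- `eq` rearranges to y + 1 = N k, so the positive number y + 1 is at least N. Then the left side
  -- of `eq` exceeds the right side by N + N x + (N - 1)(y + 1 - N), which is positive.
  k = x ℤ.+ y ℤ.- N ℤ.+ ℤ.+ 3
  diff = (N ℤ.* x ℤ.+ (N ℤ.- ℤ.1ℤ) ℤ.* y) ℤ.- (N ℤ.* ℤ.-1ℤ ℤ.+ (N ℤ.- ℤ.1ℤ) ℤ.* (N ℤ.- ℤ.1ℤ))
  diff≡0 : diff ≡ 0ℤ
  diff≡0 = ℤ.i≡j⇒i-j≡0 eq
  1≤N : ℤ.1ℤ ≤ N
  1≤N = ℤ.i<j⇒suc[i]≤j 0<N
  y+1≡Nk : y ℤ.+ ℤ.1ℤ ≡ N ℤ.* k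
  y+1≡Nk = begin-equality
    y ℤ.+ ℤ.1ℤ            ≡⟨ solve 3 (λ N x y → y :+ con ℤ.1ℤ := N :* (x :+ y :- N :+ con (ℤ.+ 3))
                               :- ((N :* x :+ (N :- con ℤ.1ℤ) :* y) :- (N :* con ℤ.-1ℤ :+ (N :- con ℤ.1ℤ) :* (N :- con ℤ.1ℤ)))) refl N x y ⟩
    N ℤ.* k ℤ.- diff      ≡⟨ cong (λ z → N ℤ.* k ℤ.- z) diff≡0 ⟩
    N ℤ.* k ℤ.+ 0ℤ        ≡⟨ ℤ.+-identityʳ _ ⟩
    N ℤ.* k               ∎
  0<k : 0ℤ ℤ.< k
  0<k = ℤ.*-cancelˡ-<-nonNeg N {{ℤ.nonNegative (ℤ.<⇒≤ 0<N)}} (begin-strict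
    N ℤ.* 0ℤ    ≡⟨ ℤ.*-zeroʳ N ⟩
    0ℤ          <⟨ ℤ.+-mono-≤-< 0≤y (ℤ.+<+ (ℕ.s≤s ℕ.z≤n)) ⟩
    y ℤ.+ ℤ.1ℤ  ≡⟨ y+1≡Nk ⟩
    N ℤ.* k     ∎)
  N≤y+1 : N ≤ y ℤ.+ ℤ.1ℤ
  N≤y+1 = begin
    N            ≡⟨ ℤ.*-identityʳ N ⟨
    N ℤ.* ℤ.1ℤ   ≤⟨ ℤ.*-monoˡ-≤-nonNeg N {{ℤ.nonNegative (ℤ.<⇒≤ 0<N)}} (ℤ.i<j⇒suc[i]≤j 0<k) ⟩
    N ℤ.* k      ≡⟨ y+1≡Nk ⟨
    y ℤ.+ ℤ.1ℤ   ∎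
  excess≡0 : N ℤ.+ N ℤ.* x ℤ.+ (N ℤ.- ℤ.1ℤ) ℤ.* (y ℤ.+ ℤ.1ℤ ℤ.- N) ≡ 0ℤ
  excess≡0 = trans
    (solve 3 (λ N x y → N :+ N :* x :+ (N :- con ℤ.1ℤ) :* (y :+ con ℤ.1ℤ :- N) :=
       (N :* x :+ (N :- con ℤ.1ℤ) :* y) :- (N :* con ℤ.-1ℤ :+ (N :- con ℤ.1ℤ) :* (N :- con ℤ.1ℤ))) refl N x y)
    diff≡0

-- The columns, the functional φ and the target vector

module Construction (n : ℤ) where

  open +-*-Solver

  -- The extra column -e_1 in front makes each lower right block a smaller ladder, down to the last
  -- column v. In `matrix` the multiple n e_d is added to this extra column, which turns it into u.
  ladder : ∀ {d} → Matrix ℤ d (suc d)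
  ladder zero    zero          = ℤ.-1ℤ
  ladder zero    (suc zero)    = n
  ladder zero    (suc (suc j)) = 0ℤ
  ladder (suc i) zero          = 0ℤ
  ladder (suc i) (suc j)       = ladder i j

  matrix : ∀ {d} → Matrix ℤ (suc d) (suc (suc d))
  matrix i zero    = ladder i zero ℤ.+ n ℤ.* e-last i
  matrix i (suc j) = ladder i (suc j)

  combination-0 : ∀ {m} (β : Vector ℤ m) → combinationℤ {1} β (λ _ _ → 0ℤ) zero ≡ 0ℤ
  combination-0 {zero}  β = refl
  combination-0 {suc m} β = cong₂ ℤ._+_ (ℤ.*-zeroʳ (β zero)) (combination-0 (tail β))

  combination-ladder : ∀ {d} (β : Vector ℤ (suc d)) i →
    combinationℤ β (columns ladder) i ≡ n ℤ.* β (suc i) ℤ.- β (inject₁ i)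
  combination-ladder {suc d} β zero = trans
    (cong (λ z → β zero ℤ.* ℤ.-1ℤ ℤ.+ (β (suc zero) ℤ.* n ℤ.+ z)) (combination-0 (tail (tail β))))
    (solve 3 (λ n a b → a :* con ℤ.-1ℤ :+ (b :* n :+ con 0ℤ) := n :* b :- a) refl n (β zero) (β (suc zero)))
  combination-ladder {suc d} β (suc i) = trans
    (cong₂ ℤ._+_ (ℤ.*-zeroʳ (β zero)) (combination-ladder (tail β) i)) (ℤ.+-identityˡ _)

  combination-matrix : ∀ {d} (β : Vector ℤ (suc (suc d))) i →
    combinationℤ β (columns matrix) i ≡
    n ℤ.* β (suc i) ℤ.- β (inject₁ i) ℤ.+ n ℤ.* β zero ℤ.* e-last i
  combination-matrix β i = trans
    (solve 5 (λ n b l e s → b :* (l :+ n :* e) :+ s := (b :* l :+ s) :+ n :* b :* e) refl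
      n (β zero) (ladder i zero) (e-last i) _)
    (cong (ℤ._+ n ℤ.* β zero ℤ.* e-last i) (combination-ladder β i))

  -- The functional φ: coordinate i, counted from 0, has weight n^i.
  horner : ∀ {d} → Vector ℤ d → ℤ
  horner {zero}  x = 0ℤ
  horner {suc d} x = x zero ℤ.+ n ℤ.* horner (tail x)

  horner-cong : ∀ {d} {x y : Vector ℤ d} → x ≋ℤ y → horner x ≡ horner y
  horner-cong {zero}  x≋y = refl
  horner-cong {suc d} x≋y = cong₂ (λ a b → a ℤ.+ n ℤ.* b) (x≋y zero) (horner-cong (λ i → x≋y (suc i)))

  -- With weight n^i on row i, the term in `β (suc i)` cancels against the next row, which leaves
  -- the two ends of `β` and the term in `κ`. `κ` stands for `β zero`; it is a separate variable
  -- because the induction passes to `tail β`.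
  horner-telescopes : ∀ {d} (β : Vector ℤ (suc (suc d))) κ →
    horner (λ i → n ℤ.* β (suc i) ℤ.- β (inject₁ i) ℤ.+ n ℤ.* κ ℤ.* e-last i) ≡
    n ℤ.^ suc d ℤ.* β (Fin.fromℕ (suc d)) ℤ.- β zero ℤ.+ n ℤ.^ suc d ℤ.* κ
  horner-telescopes {zero} β κ =
    solve 4 (λ n a b κ → n :* b :- a :+ n :* κ :* con ℤ.1ℤ :+ n :* con 0ℤ :=
      n :* con ℤ.1ℤ :* b :- a :+ n :* con ℤ.1ℤ :* κ) refl n (β zero) (β (suc zero)) κ
  horner-telescopes {suc d} β κ = trans
    (cong (λ z → n ℤ.* β (suc zero) ℤ.- β zero ℤ.+ n ℤ.* κ ℤ.* 0ℤ ℤ.+ n ℤ.* z)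
      (horner-telescopes (tail β) κ))
    (solve 6 (λ n a b c p κ → n :* b :- a :+ n :* κ :* con 0ℤ :+ n :* (p :* c :- b :+ p :* κ) :=
      n :* p :* c :- a :+ n :* p :* κ) refl
      n (β zero) (β (suc zero)) (β (Fin.fromℕ (suc (suc d)))) (n ℤ.^ suc d) κ)

  horner-combination : ∀ {d} (β : Vector ℤ (suc (suc d))) →
    horner (combinationℤ β (columns matrix)) ≡
    n ℤ.^ suc d ℤ.* β (Fin.fromℕ (suc d)) ℤ.+ (n ℤ.^ suc d ℤ.- ℤ.1ℤ) ℤ.* β zero
  horner-combination {d} β = trans (horner-cong (combination-matrix β)) (trans
    (horner-telescopes β (β zero))
    (solve 3 (λ N a b → N :* b :- a :+ N :* a := N :* b :+ (N :- con ℤ.1ℤ) :* a) refl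
      (n ℤ.^ suc d) (β zero) (β (Fin.fromℕ (suc d)))))

  descending : ∀ {d} → Vector ℤ (suc d)
  descending {d}     zero    = n ℤ.^ d
  descending {suc d} (suc j) = descending j

  descending-inject₁ : ∀ {d} (i : Fin d) → descending (inject₁ i) ≡ n ℤ.* descending (suc i)
  descending-inject₁ zero    = refl
  descending-inject₁ (suc i) = descending-inject₁ i

  module Coefficients (d : ℕ) where

    N : ℤ
    N = n ℤ.^ suc d

    -- The values -1 at v and N - 1 at u make φ(b) the Frobenius number. The middle columns lie in
    -- the kernel of φ, so their coefficients are free; N - 1 keeps them large after half of the
    -- relation is added.
    c : Vector ℤ (suc (suc d))
    c j = N ℤ.- ℤ.1ℤ ℤ.- N ℤ.* e-last j

    b : Vector ℤ (suc d)
    b = combinationℤ c (columns matrix)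

    -- Twice the real coefficients: 2c plus the relation between the columns whose
    -- coefficients are -n^(d+1), -n^d, …, -n, N - 1.
    m : Vector ℤ (suc (suc d))
    m j = (N ℤ.+ N ℤ.- ℤ.+ 2) ℤ.- (N ℤ.* e-last j ℤ.+ descending j)

    -- With e = `e-last i` and p = `descending (suc i)`, the part m - 2c contributes n (N e - p) + n
    -- p - n N e = 0 in row i. Leaving e a variable treats the last row along with the others.
    combination-m : ∀ i → combinationℤ m (columns matrix) i ≡ b i ℤ.+ b i
    combination-m i = trans (combination-matrix m i) (trans double
        (sym (cong₂ ℤ._+_ (combination-matrix c i) (combination-matrix c i))))
      where
      double : n ℤ.* m (suc i) ℤ.- m (inject₁ i) ℤ.+ n ℤ.* m zero ℤ.* e-last i ≡
               (n ℤ.* c (suc i) ℤ.- c (inject₁ i) ℤ.+ n ℤ.* c zero ℤ.* e-last i) ℤ.+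
               (n ℤ.* c (suc i) ℤ.- c (inject₁ i) ℤ.+ n ℤ.* c zero ℤ.* e-last i)
      double rewrite descending-inject₁ i | e-last-inject₁ i = solve 4 (λ n N e p →
        let N-1 = N :- con ℤ.1ℤ
            2N-2 = N :+ N :- con (ℤ.+ 2)
            row = n :* (N-1 :- N :* e) :- (N-1 :- N :* con 0ℤ) :+ n :* (N-1 :- N :* con 0ℤ) :* e
        in n :* (2N-2 :- (N :* e :+ p)) :- (2N-2 :- (N :* con 0ℤ :+ n :* p)) :+
           n :* (2N-2 :- (N :* con 0ℤ :+ N)) :* e := row :+ row) refl n N (e-last i) (descending (suc i))

    no-combination : 0ℤ ℤ.< N → ¬ (Σ[ β ∈ Vector ℤ (suc (suc d)) ]
      (∀ i → 0ℤ ≤ β i) × b ≋ℤ combinationℤ β (columns matrix))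
    no-combination 0<N (β , 0≤β , b≋) =
      frobenius (β (Fin.fromℕ (suc d))) (β zero) 0<N (0≤β _) (0≤β _) (trans
        (sym (trans (horner-cong b≋) (horner-combination β)))
        (trans (horner-combination c) (cong₂ (λ x y → N ℤ.* x ℤ.+ (N ℤ.- ℤ.1ℤ) ℤ.* y)
          (trans (cong (λ e → N ℤ.- ℤ.1ℤ ℤ.- N ℤ.* e) (e-last-fromℕ d))
             (solve 1 (λ N → N :- con ℤ.1ℤ :- N :* con ℤ.1ℤ := con ℤ.-1ℤ) refl N))
          (solve 1 (λ N → N :- con ℤ.1ℤ :- N :* con 0ℤ := N :- con ℤ.1ℤ) refl N))))

-- Column norms and the size of the coefficients

module ℤΣ = SemiringDefinitions ℤ.+-*-rawSemiring
module ℚΣ = SemiringDefinitions ℚ.+-*-rawSemiring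
module ℝΣ = SemiringDefinitions ℝ-rawSemiring

norm² : ∀ {d} → Vector ℤ d → ℤ
norm² v = ℤΣ.sum (λ i → v i ℤ.* v i)

norm²-0 : ∀ d → norm² {d} (λ _ → 0ℤ) ≡ 0ℤ
norm²-0 zero    = refl
norm²-0 (suc d) = cong (ℤ._+_ 0ℤ) (norm²-0 d)

module ConstructionBounds (n : ℤ) (1≤n : ℤ.1ℤ ≤ n) where

  open Construction n
  open ℤ.≤-Reasoning
  open +-*-Solver

  private
    0≤n : 0ℤ ≤ n
    0≤n = ℤ.≤-trans (ℤ.+≤+ ℕ.z≤n) 1≤n

    n²+1 : ℤ
    n²+1 = n ℤ.* n ℤ.+ ℤ.1ℤ

    1≤n²+1 : ℤ.1ℤ ≤ n²+1
    1≤n²+1 = ℤ.+-monoˡ-≤ ℤ.1ℤ (0≤i*j 0≤n 0≤n)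

  norm²-ladder-first : ∀ {d} → norm² (columns (ladder {d}) zero) ≤ ℤ.1ℤ
  norm²-ladder-first {zero}  = ℤ.+≤+ ℕ.z≤n
  norm²-ladder-first {suc d} = ℤ.≤-reflexive (cong (ℤ._+_ ℤ.1ℤ) (norm²-0 d))

  norm²-ladder : ∀ {d} j → norm² (columns (ladder {d}) j) ≤ n²+1
  norm²-ladder {d}     zero          = ℤ.≤-trans (norm²-ladder-first {d}) 1≤n²+1
  norm²-ladder {suc d} (suc zero)    = ℤ.+-monoʳ-≤ (n ℤ.* n) (norm²-ladder-first {d})
  norm²-ladder {suc d} (suc (suc j)) = subst (_≤ n²+1) (sym (ℤ.+-identityˡ _)) (norm²-ladder {d} (suc j))

  norm²-e-last : ∀ {d} → norm² (λ i → 0ℤ ℤ.+ n ℤ.* e-last {d} i) ≡ n ℤ.* n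
  norm²-e-last {zero}  = solve 1 (λ n → (con 0ℤ :+ n :* con ℤ.1ℤ) :* (con 0ℤ :+ n :* con ℤ.1ℤ) :+ con 0ℤ := n :* n) refl n
  norm²-e-last {suc d} = trans
    (cong₂ (λ x y → (0ℤ ℤ.+ x) ℤ.* (0ℤ ℤ.+ x) ℤ.+ y) (ℤ.*-zeroʳ n) (norm²-e-last {d}))
    (ℤ.+-identityˡ _)

  -- Every column has one entry n and at most one entry -1, in different rows. Passing from n² + 1
  -- to the square of n + 1 gives an integer bound on the norms.
  norm²-matrix : ∀ {d} j → norm² (columns (matrix {suc d}) j) ≤ (n ℤ.+ ℤ.1ℤ) ℤ.* (n ℤ.+ ℤ.1ℤ)
  norm²-matrix {d} j = ℤ.≤-trans (bound {d} j) (begin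
    n²+1                                   ≡⟨ ℤ.+-identityʳ n²+1 ⟨
    n²+1 ℤ.+ 0ℤ                            ≤⟨ ℤ.+-monoʳ-≤ n²+1 (ℤ.+-mono-≤ 0≤n 0≤n) ⟩
    n²+1 ℤ.+ (n ℤ.+ n)                     ≡⟨ solve 1 (λ n → n :* n :+ con ℤ.1ℤ :+ (n :+ n) :=
                                                (n :+ con ℤ.1ℤ) :* (n :+ con ℤ.1ℤ)) refl n ⟩
    (n ℤ.+ ℤ.1ℤ) ℤ.* (n ℤ.+ ℤ.1ℤ)          ∎)
    where
    bound : ∀ {d} j → norm² (columns (matrix {suc d}) j) ≤ n²+1
    bound {d} (suc j) = norm²-ladder {suc (suc d)} (suc j)
    bound {d} zero    = ℤ.≤-reflexive (trans
      (cong₂ (λ x y → (ℤ.-1ℤ ℤ.+ x) ℤ.* (ℤ.-1ℤ ℤ.+ x) ℤ.+ y) (ℤ.*-zeroʳ n) (norm²-e-last {d}))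
      (ℤ.+-comm ℤ.1ℤ (n ℤ.* n)))

  -- Before the last index only a power of n that is at most `X` is present, and at the last index
  -- this power has dropped to 1. `X` is kept apart from `n ^ d` because the induction lowers d
  -- alone.
  descending-bound : ∀ {d} X → n ℤ.^ d ≤ X → ∀ j → X ℤ.* e-last j ℤ.+ descending {d} j ≤ X ℤ.+ ℤ.1ℤ
  descending-bound {zero}  X N≤X zero    = ℤ.≤-reflexive (cong (ℤ._+ ℤ.1ℤ) (ℤ.*-identityʳ X))
  descending-bound {suc d} X N≤X zero    = begin
    X ℤ.* 0ℤ ℤ.+ n ℤ.^ suc d   ≡⟨ cong (ℤ._+ n ℤ.^ suc d) (ℤ.*-zeroʳ X) ⟩
    0ℤ ℤ.+ n ℤ.^ suc d         ≡⟨ ℤ.+-identityˡ _ ⟩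
    n ℤ.^ suc d                ≤⟨ N≤X ⟩
    X                          ≤⟨ ℤ.i≤i+j X (ℤ.+ 1) ⟩
    X ℤ.+ ℤ.1ℤ                 ∎
  descending-bound {suc d} X N≤X (suc j) = descending-bound X (ℤ.≤-trans n^d≤n^1+d N≤X) j
    where
    0≤n^ : ∀ k → 0ℤ ≤ n ℤ.^ k
    0≤n^ zero    = ℤ.+≤+ ℕ.z≤n
    0≤n^ (suc k) = 0≤i*j 0≤n (0≤n^ k)
    n^d≤n^1+d : n ℤ.^ d ≤ n ℤ.^ suc d
    n^d≤n^1+d = begin
      n ℤ.^ d             ≡⟨ ℤ.*-identityˡ _ ⟨
      ℤ.1ℤ ℤ.* n ℤ.^ d    ≤⟨ ℤ.*-monoʳ-≤-nonNeg (n ℤ.^ d) {{ℤ.nonNegative (0≤n^ d)}} 1≤n ⟩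
      n ℤ.* n ℤ.^ d       ∎

  module _ (d : ℕ) where

    open Coefficients d

    -- This is m_j / 2 ≥ 2N / 10 + 1 cleared of denominators: 2N / 10 will bound the threshold, and
    -- 1 is the margin for strictness. It follows from m_j ≥ N - 3.
    m-bound : ℤ.+ 9 ≤ N → ∀ j → N ℤ.+ N ℤ.+ ℤ.+ 10 ≤ ℤ.+ 5 ℤ.* m j
    m-bound 9≤N j = begin
      N ℤ.+ N ℤ.+ ℤ.+ 10
        -- 10 ≤ 12 = 3 · 9 - 15 ≤ 3N - 15.
        ≤⟨ ℤ.+-monoʳ-≤ (N ℤ.+ N) (ℤ.≤-trans (ℤ.i≤i+j (ℤ.+ 10) (ℤ.+ 2)) (ℤ.+-monoˡ-≤ (ℤ.- ℤ.+ 15)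
             (ℤ.*-monoˡ-≤-nonNeg (ℤ.+ 3) 9≤N))) ⟩
      N ℤ.+ N ℤ.+ (ℤ.+ 3 ℤ.* N ℤ.- ℤ.+ 15)
        ≡⟨ solve 1 (λ N → N :+ N :+ (con (ℤ.+ 3) :* N :- con (ℤ.+ 15)) :=
             con (ℤ.+ 5) :* (N :+ N :- con (ℤ.+ 2) :- (N :+ con ℤ.1ℤ))) refl N ⟩
      ℤ.+ 5 ℤ.* (N ℤ.+ N ℤ.- ℤ.+ 2 ℤ.- (N ℤ.+ ℤ.1ℤ))
        ≤⟨ ℤ.*-monoˡ-≤-nonNeg (ℤ.+ 5) (ℤ.+-monoʳ-≤ (N ℤ.+ N ℤ.- ℤ.+ 2)
             (ℤ.neg-mono-≤ (descending-bound N ℤ.≤-refl j))) ⟩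
      ℤ.+ 5 ℤ.* m j ∎

-- Comparing powers of n + 1 and n

-- Bernoulli's inequality (1 - 1/(n+1))^k ≥ 1 - k/(n+1), with r = n - k.
bernoulli : ∀ {n} k r → k ℕ.+ r ≡ n → suc n ℕ.^ k ℕ.* r ℕ.≤ n ℕ.^ k ℕ.* n
bernoulli     zero    r refl = ℕ.≤-refl
bernoulli {n} (suc k) r k+r≡n = begin
  suc n ℕ.* suc n ℕ.^ k ℕ.* r      ≡⟨ swap (suc n) (suc n ℕ.^ k) r ⟩
  -- `r≤n` gives (n + 1) r ≤ n (r + 1), which trades one factor n + 1 for n.
  suc n ℕ.^ k ℕ.* (suc n ℕ.* r)    ≤⟨ ℕ.*-monoʳ-≤ (suc n ℕ.^ k) (ℕ.+-monoˡ-≤ (n ℕ.* r) r≤n) ⟩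
  suc n ℕ.^ k ℕ.* (n ℕ.+ n ℕ.* r)  ≡⟨ cong (suc n ℕ.^ k ℕ.*_) (ℕ.*-suc n r) ⟨
  suc n ℕ.^ k ℕ.* (n ℕ.* suc r)    ≡⟨ swap n (suc n ℕ.^ k) (suc r) ⟨
  n ℕ.* suc n ℕ.^ k ℕ.* suc r      ≡⟨ ℕ.*-assoc n _ _ ⟩
  n ℕ.* (suc n ℕ.^ k ℕ.* suc r)    ≤⟨ ℕ.*-monoʳ-≤ n (bernoulli k (suc r) (trans (ℕ.+-suc k r) k+r≡n)) ⟩
  n ℕ.* (n ℕ.^ k ℕ.* n)            ≡⟨ ℕ.*-assoc n _ _ ⟨
  n ℕ.* n ℕ.^ k ℕ.* n              ∎
  where
  open ℕ.≤-Reasoning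
  r≤n : r ℕ.≤ n
  r≤n = subst (r ℕ.≤_) k+r≡n (ℕ.m≤n+m r (suc k))
  swap : ∀ a b c → a ℕ.* b ℕ.* c ≡ b ℕ.* (a ℕ.* c)
  swap a b c = trans (cong (ℕ._* c) (ℕ.*-comm a b)) (ℕ.*-assoc b a c)

-- Bernoulli with k = r = d: the outer factors d and 2d have ratio 2. This is the reason for the
-- choice n = 2d.
[1+2d]^d≤2[2d]^d : ∀ d .{{_ : ℕ.NonZero d}} →
                   suc (d ℕ.+ d) ℕ.^ d ℕ.≤ (d ℕ.+ d) ℕ.^ d ℕ.+ (d ℕ.+ d) ℕ.^ d
[1+2d]^d≤2[2d]^d d = ℕ.*-cancelʳ-≤ _ _ d (begin
  suc (d ℕ.+ d) ℕ.^ d ℕ.* d                       ≤⟨ bernoulli d d refl ⟩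
  P ℕ.* (d ℕ.+ d)                                 ≡⟨ ℕ.*-distribˡ-+ P d d ⟩
  P ℕ.* d ℕ.+ P ℕ.* d                             ≡⟨ ℕ.*-distribʳ-+ d P P ⟨
  (P ℕ.+ P) ℕ.* d                                 ∎)
  where
  open ℕ.≤-Reasoning
  P = (d ℕ.+ d) ℕ.^ d

pos-^ : ∀ n k → ℤ.+ (n ℕ.^ k) ≡ (ℤ.+ n) ℤ.^ k
pos-^ n zero    = refl
pos-^ n (suc k) = trans (ℤ.pos-* n (n ℕ.^ k)) (cong (ℤ.+ n ℤ.*_) (pos-^ n k))

-- Integers as rationals, and the terms of real sums

ι : ℤ → ℚ
ι z = z ℚ./ 1

toℚᵘ-ι : ∀ z → ℚ.toℚᵘ (ι z) ℚᵘ.≃ ℚᵘ.mkℚᵘ z 0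
toℚᵘ-ι z = ℚ.toℚᵘ-fromℚᵘ (ℚᵘ.mkℚᵘ z 0)

ι-+ : ∀ x y → ι (x ℤ.+ y) ≡ ι x ℚ.+ ι y
ι-+ x y = ℚ.toℚᵘ-injective (begin
  ℚ.toℚᵘ (ι (x ℤ.+ y))               ≈⟨ toℚᵘ-ι (x ℤ.+ y) ⟩
  ℚᵘ.mkℚᵘ (x ℤ.+ y) 0                ≡⟨ cong₂ (λ a b → ℚᵘ.mkℚᵘ (a ℤ.+ b) 0) (ℤ.*-identityʳ x) (ℤ.*-identityʳ y) ⟨
  ℚᵘ.mkℚᵘ x 0 ℚᵘ.+ ℚᵘ.mkℚᵘ y 0       ≈⟨ ℚᵘ.+-cong (toℚᵘ-ι x) (toℚᵘ-ι y) ⟨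
  ℚ.toℚᵘ (ι x) ℚᵘ.+ ℚ.toℚᵘ (ι y)     ≈⟨ ℚ.toℚᵘ-homo-+ (ι x) (ι y) ⟨
  ℚ.toℚᵘ (ι x ℚ.+ ι y)               ∎)
  where open ℚᵘ.≃-Reasoning

ι-* : ∀ x y → ι (x ℤ.* y) ≡ ι x ℚ.* ι y
ι-* x y = ℚ.toℚᵘ-injective (begin
  ℚ.toℚᵘ (ι (x ℤ.* y))               ≈⟨ toℚᵘ-ι (x ℤ.* y) ⟩
  ℚᵘ.mkℚᵘ x 0 ℚᵘ.* ℚᵘ.mkℚᵘ y 0       ≈⟨ ℚᵘ.*-cong (toℚᵘ-ι x) (toℚᵘ-ι y) ⟨
  ℚ.toℚᵘ (ι x) ℚᵘ.* ℚ.toℚᵘ (ι y)     ≈⟨ ℚ.toℚᵘ-homo-* (ι x) (ι y) ⟨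
  ℚ.toℚᵘ (ι x ℚ.* ι y)               ∎)
  where open ℚᵘ.≃-Reasoning

ι-mono-≤ : ∀ {x y} → x ≤ y → ι x ℚ.≤ ι y
ι-mono-≤ {x} {y} x≤y = ℚ.toℚᵘ-cancel-≤
  (ℚᵘ.≤-respˡ-≃ (ℚᵘ.≃-sym (toℚᵘ-ι x)) (ℚᵘ.≤-respʳ-≃ (ℚᵘ.≃-sym (toℚᵘ-ι y))
    (ℚᵘ.*≤* (ℤ.*-monoʳ-≤-nonNeg ℤ.1ℤ x≤y))))

0≤ι : ∀ {z} → 0ℤ ≤ z → 0ℚ ℚ.≤ ι z
0≤ι = ι-mono-≤

seq-sum : ∀ {l} (v : Vector ℝ l) k → seq (ℝΣ.sum v) k ≡ ℚΣ.sum (λ i → seq (v i) k)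
seq-sum {zero}  v k = refl
seq-sum {suc l} v k = cong (seq (v zero) k ℚ.+_) (seq-sum (tail v) k)

-- Serves both `ι` and half of `ι`; the latter is not multiplicative, so only additivity is assumed.
module Additive (f : ℤ → ℚ) (f-0 : f 0ℤ ≡ 0ℚ) (f-+ : ∀ x y → f (x ℤ.+ y) ≡ f x ℚ.+ f y) where

  sum-homo : ∀ {l} (g : Vector ℚ l) (v : Vector ℤ l) → (∀ i → g i ≡ f (v i)) → ℚΣ.sum g ≡ f (ℤΣ.sum v)
  sum-homo {zero}  g v g≡fv = sym f-0
  sum-homo {suc l} g v g≡fv = trans (cong₂ ℚ._+_ (g≡fv zero) (sum-homo (tail g) (tail v) (λ i → g≡fv (suc i))))
    (sym (f-+ (v zero) (ℤΣ.sum (tail v))))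

seq-norm² : ∀ {d} (v : Vector ℤ d) k → seq (ℝΣ.sum (λ i → toℝ v i ^ 2)) k ≡ ι (norm² v)
seq-norm² v k = trans (seq-sum (λ i → toℝ v i ^ 2) k)
  (Additive.sum-homo ι refl ι-+ _ (λ i → v i ℤ.* v i)
    λ i → trans (cong (ι (v i) ℚ.*_) (ℚ.*-identityʳ (ι (v i)))) (sym (ι-* (v i) (v i))))

seq-half-combination : ∀ {d l} (A : Matrix ℤ d l) (μ : Vector ℤ l) i k →
  seq (combinationℝ (λ j → fromℚ (½ ℚ.* ι (μ j))) (λ j → toℝ (columns A j)) i) k ≡
  ½ ℚ.* ι (combinationℤ μ (columns A) i)
seq-half-combination A μ i k = trans (seq-sum (λ j → fromℚ (½ ℚ.* ι (μ j)) * toℝ (columns A j) i) k)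
  (Additive.sum-homo (λ z → ½ ℚ.* ι z) refl
    (λ x y → trans (cong (½ ℚ.*_) (ι-+ x y)) (ℚ.*-distribˡ-+ ½ (ι x) (ι y))) _ (λ j → μ j ℤ.* A i j)
    λ j → trans (ℚ.*-assoc ½ (ι (μ j)) (ι (A i j))) (cong (½ ℚ.*_) (sym (ι-* (μ j) (A i j)))))

-- Termwise estimates of norms, powers and the threshold

-- The bound holds for every term of the sequence, so that no limit is involved.
record _∈[0,_] (x : ℝ) (q : ℚ) : Set where
  field
    lower : ∀ k → 0ℚ ℚ.≤ seq x k
    upper : ∀ k → seq x k ℚ.≤ q
open _∈[0,_]

-- `√ℚ` rounds down, so the square of every term is at most `norm² v`, and no error depending on the
-- index arises.
norm-bound : ∀ {d} (v : Vector ℤ d) {r} → 0ℤ ≤ r → norm² v ≤ r ℤ.* r → ‖ toℝ v ‖ ∈[0, ι r ]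
norm-bound v {r} 0≤r v²≤r² = record
  { lower = λ k → 0≤√ℚ k (q k)
  ; upper = λ k → ℚ.≮⇒≥ λ r<√ → ℚ.<-irrefl refl (begin-strict
      ι r ℚ.* ι r              <⟨ square-< r<√ ⟩
      √ℚ k (q k) ℚ.* √ℚ k (q k)  ≤⟨ √ℚ²≤ k (ℚ.p≤q⊔p (s k) 0ℚ) ⟩
      s k ℚ.⊔ 0ℚ               ≡⟨ cong (ℚ._⊔ 0ℚ) (seq-norm² v k) ⟩
      ι (norm² v) ℚ.⊔ 0ℚ       ≤⟨ ℚ.⊔-lub {_} {ι (norm² v)} {0ℚ} (ι-mono-≤ v²≤r²)
                                   (0≤ι (0≤i*j 0≤r 0≤r)) ⟩
      ι (r ℤ.* r)              ≡⟨ ι-* r r ⟩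
      ι r ℚ.* ι r              ∎)
  }
  where
  open ℚ.≤-Reasoning
  s : ℕ → ℚ
  s k = seq (ℝΣ.sum (λ i → toℝ v i ^ 2)) k
  q : ℕ → ℚ
  q k = s k ℚ.⊔ 0ℚ
  square-< : ∀ {t} → ι r ℚ.< t → ι r ℚ.* ι r ℚ.< t ℚ.* t
  square-< {t} r<t = ℚ.≤-<-trans
    (ℚ.*-monoˡ-≤-nonNeg (ι r) {{ℚ.nonNegative (0≤ι 0≤r)}} (ℚ.<⇒≤ r<t))
    (ℚ.*-monoˡ-<-pos t {{ℚ.positive (ℚ.≤-<-trans (0≤ι 0≤r) r<t)}} r<t)

foldr-⊔-bound : ∀ {l q x} (v : Vector ℝ l) → x ∈[0, q ] → (∀ j → v j ∈[0, q ]) → foldr _⊔_ x v ∈[0, q ]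
foldr-⊔-bound {zero}          v x∈ v∈ = x∈
foldr-⊔-bound {suc l} {q} {x} v x∈ v∈ = record
  { lower = λ k → ℚ.≤-trans (lower (v∈ zero) k) (ℚ.p≤p⊔q (seq (v zero) k) (seq (foldr _⊔_ x (tail v)) k))
  ; upper = λ k → ℚ.⊔-lub {_} {seq (v zero) k} (upper (v∈ zero) k)
                    (upper (foldr-⊔-bound (tail v) x∈ (λ j → v∈ (suc j))) k)
  }

^-bound : ∀ {x r} k → 0ℤ ≤ r → x ∈[0, ι r ] → (x ^ k) ∈[0, ι (r ℤ.^ k) ]
^-bound zero    0≤r x∈ = record { lower = λ _ → ℚ.<⇒≤ (ℚ.positive⁻¹ 1ℚ) ; upper = λ _ → ℚ.≤-refl }
^-bound {x} {r} (suc k) 0≤r x∈ = record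
  { lower = λ i → 0≤p*q (lower x∈ i) (lower ih i)
  ; upper = λ i → subst (_ ℚ.≤_) (sym (ι-* r (r ℤ.^ k)))
      -- The bound `ι (r ℤ.^ k)` is non-negative since it lies above a non-negative term, here the
      -- one at index 0.
      (*-mono-≤-nonNeg (lower x∈ i) (ℚ.≤-trans (lower ih 0) (upper ih 0)) (upper x∈ i) (upper ih i))
  }
  where ih = ^-bound k 0≤r x∈

-- The root of q is at least 1, and rounding down loses less than the grid step 1/(k + 1), which is
-- at most ½ from index 1 on.
½≤√ℚ : ∀ k q → 1 ℕ.≤ k → 1ℚ ℚ.≤ q → ½ ℚ.≤ √ℚ k q
½≤√ℚ k q 1≤k 1≤q = ℚ.≮⇒≥ λ s<½ → ℚ.<-irrefl refl (ℚ.<-≤-trans (ℚ.≤-<-trans 1≤q (<√ℚ+² k q))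
  (p≤q⇒p²≤q² (ℚ.+-mono-≤ (0≤√ℚ k q) (0≤grid k 1))
    (ℚ.+-mono-≤ (ℚ.<⇒≤ s<½) (proj₂ (grid-archimedean ½ (ℚ.positive⁻¹ ½)) k 1≤k))))

1/10ℚ : ℚ
1/10ℚ = ℤ.+ 1 ℚ./ 10

quotient-bound : ∀ {d} (d≥2 : 2 ℕ.≤ d) {x q} → x ∈[0, q ] → ∀ k → 1 ℕ.≤ k →
  seq (x / (fromℕ 20 * √ fromℕ d) [ 0<20√ d≥2 ]) k ℚ.≤ q ℚ.* 1/10ℚ
quotient-bound {d} d≥2 {x} {q} x∈ k 1≤k = *-mono-≤-nonNeg
  (lower x∈ k) (ℚ.nonNegative⁻¹ 1/10ℚ) (upper x∈ k)
  -- From index 1 on the terms of 20√d are at least 20 · ½ = 10, uniformly in d; clamping can only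
  -- raise them.
  (1/-antimono-≤ (ι (ℤ.+ 10)) (I.clamp k) (ℚ.positive⁻¹ _) (I.0<clamp k)
    (ℚ.≤-trans (ℚ.*-monoˡ-≤-nonNeg (ι (ℤ.+ 20)) (½≤√ℚ k (ι (ℤ.+ d) ℚ.⊔ 0ℚ) 1≤k
      (ℚ.≤-trans (ι-mono-≤ (ℤ.+≤+ (ℕ.≤-trans (ℕ.s≤s ℕ.z≤n) d≥2))) (ℚ.p≤p⊔q (ι (ℤ.+ d)) 0ℚ))))
      (ℚ.p≤p⊔q (seq (fromℕ 20 * √ fromℕ d) k) I.ε)))
  where module I = Inverse (fromℕ 20 * √ fromℕ d) (0<20√ d≥2)

tenth-bound : ∀ {x y} → y ℤ.+ ℤ.+ 10 ≤ ℤ.+ 5 ℤ.* x → ι y ℚ.* 1/10ℚ ℚ.+ 1ℚ ℚ.≤ ½ ℚ.* ι x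
tenth-bound {x} {y} y+10≤5x = begin
  ι y ℚ.* 1/10ℚ ℚ.+ 1ℚ              ≡⟨ ℚ.*-distribʳ-+ 1/10ℚ (ι y) (ι (ℤ.+ 10)) ⟨
  (ι y ℚ.+ ι (ℤ.+ 10)) ℚ.* 1/10ℚ    ≡⟨ cong (ℚ._* 1/10ℚ) (ι-+ y (ℤ.+ 10)) ⟨
  ι (y ℤ.+ ℤ.+ 10) ℚ.* 1/10ℚ        ≤⟨ ℚ.*-monoʳ-≤-nonNeg 1/10ℚ (ι-mono-≤ y+10≤5x) ⟩
  ι (ℤ.+ 5 ℤ.* x) ℚ.* 1/10ℚ         ≡⟨ cong (ℚ._* 1/10ℚ) (ι-* (ℤ.+ 5) x) ⟩
  ι (ℤ.+ 5) ℚ.* ι x ℚ.* 1/10ℚ       ≡⟨ cong (ℚ._* 1/10ℚ) (ℚ.*-comm (ι (ℤ.+ 5)) (ι x)) ⟩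
  ι x ℚ.* ι (ℤ.+ 5) ℚ.* 1/10ℚ       ≡⟨ ℚ.*-assoc (ι x) (ι (ℤ.+ 5)) 1/10ℚ ⟩
  ι x ℚ.* ½                         ≡⟨ ℚ.*-comm (ι x) ½ ⟩
  ½ ℚ.* ι x                         ∎
  where open ℚ.≤-Reasoning

exceeds-threshold : ∀ {d} (d≥2 : 2 ℕ.≤ d) {x r y z} → 0ℤ ≤ r → x ∈[0, ι r ] →
  r ℤ.^ d ≤ y → y ℤ.+ ℤ.+ 10 ≤ ℤ.+ 5 ℤ.* z →
  fromℚ (½ ℚ.* ι z) > x ^ d / (fromℕ 20 * √ fromℕ d) [ 0<20√ d≥2 ]
exceeds-threshold {d} d≥2 {x} {r} {y} {z} 0≤r x∈ r^d≤y y+10≤5z =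
  -- The gap 1 is the summand 10 of the hypothesis divided by 10; index 1 is where `quotient-bound`
  -- starts to apply.
  1ℚ , ℚ.positive⁻¹ 1ℚ , 1 , λ k 1≤k → ℚ.≤-trans
    (ℚ.+-monoˡ-≤ 1ℚ (quotient-bound d≥2 {x ^ d} {ι (r ℤ.^ d)} (^-bound {x} {r} d 0≤r x∈) k 1≤k))
    (tenth-bound {z} {r ℤ.^ d} (ℤ.≤-trans (ℤ.+-monoˡ-≤ (ℤ.+ 10) r^d≤y) y+10≤5z))

-- Real coefficients and the final assembly

≡⇒≈ : ∀ {x y} → (∀ k → seq x k ≡ seq y k) → x ≈ y
≡⇒≈ {x} {y} x≡y ε 0<ε = 0 , λ k _ → subst (λ q → ℚ.∣ seq x k ℚ.- q ∣ ℚ.≤ ε) (x≡y k) (∣p-p∣≤ε (seq x k) 0<ε)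

half-double : ∀ {x y} → x ≡ y ℤ.+ y → ½ ℚ.* ι x ≡ ι y
half-double {_} {y} refl =
  trans (cong (½ ℚ.*_) (ι-+ y y)) (trans (ℚ.*-distribˡ-+ ½ (ι y) (ι y)) (½*p+½*p≡p (ι y)))

half-combination : ∀ {d l} (A : Matrix ℤ d l) (μ : Vector ℤ l) (v : Vector ℤ d) →
  (∀ i → combinationℤ μ (columns A) i ≡ v i ℤ.+ v i) →
  toℝ v ≋ℝ combinationℝ (λ j → fromℚ (½ ℚ.* ι (μ j))) (λ j → toℝ (columns A j))
half-combination A μ v eq i = ≡⇒≈ {toℝ v i} {combinationℝ (λ j → fromℚ (½ ℚ.* ι (μ j))) (λ j → toℝ (columns A j)) i} λ k →
  sym (trans (seq-half-combination A μ i k) (half-double {combinationℤ μ (columns A) i} {v i} (eq i)))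

maximum-bound : ∀ {l q} (v : Vector ℝ (suc l)) → (∀ j → v j ∈[0, q ]) → maximum v ∈[0, q ]
maximum-bound v v∈ = foldr-⊔-bound (tail v) (v∈ zero) (λ j → v∈ (suc j))

-- The coefficients are m_j / 2. Everything about reals is settled here for an arbitrary integer
-- matrix, with `r` bounding the column norms and `y` bounding `r ^ d`, so that only integer facts
-- remain to be supplied.
large-real-combination : ∀ {d} (d≥2 : 2 ℕ.≤ d) (A : Matrix ℤ d (suc d)) (c m : Vector ℤ (suc d)) {r y : ℤ} →
  0ℤ ≤ r → (∀ j → norm² (columns A j) ≤ r ℤ.* r) →
  r ℤ.^ d ≤ y → (∀ j → y ℤ.+ ℤ.+ 10 ≤ ℤ.+ 5 ℤ.* m j) →
  (∀ i → combinationℤ m (columns A) i ≡ combinationℤ c (columns A) i ℤ.+ combinationℤ c (columns A) i) →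
  Σ[ α ∈ Vector ℝ (suc d) ]
    (∀ i → α i > maximum (λ j → ‖ toℝ (columns A j) ‖) ^ d / (fromℕ 20 * √ fromℕ d) [ 0<20√ d≥2 ])
    × toℝ (combinationℤ c (columns A)) ≋ℝ combinationℝ α (λ i → toℝ (columns A i))
large-real-combination d≥2 A c m {r} {y} 0≤r norm²≤r² r^d≤y y+10≤5m m≡2c =
  (λ j → fromℚ (½ ℚ.* ι (m j))) ,
  (λ i → exceeds-threshold d≥2 {r = r} {y} {m i} 0≤r
    (maximum-bound (λ j → ‖ toℝ (columns A j) ‖) (λ j → norm-bound (columns A j) {r} 0≤r (norm²≤r² j)))
    r^d≤y (y+10≤5m i)) ,
  half-combination A m (combinationℤ c (columns A)) m≡2c

theorem5p1 : ∀ (d : ℕ) (d≥2 : 2 ℕ.≤ d) →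
    Σ[ A ∈ Matrix ℤ d (suc d) ] Σ[ b ∈ Vector ℤ d ]
    let a = columns A in
    b ∈ 𝓛 a
    × (Σ[ α ∈ Vector ℝ (suc d) ]
    (∀ i → α i > maximum (λ j → ‖ toℝ (a j) ‖) ^ d / (fromℕ 20 * √ fromℕ d) [ 0<20√ d≥2 ])
    × toℝ b ≋ℝ combinationℝ α (λ i → toℝ (a i)))
    × ¬ (Σ[ β ∈ Vector ℤ (suc d) ]
    (∀ i → 0ℤ ≤ β i)
    × b ≋ℤ combinationℤ β a)
theorem5p1 (suc zero) (ℕ.s≤s ())
theorem5p1 d@(suc (suc d′)) d≥2 =
  matrix , combinationℤ c (columns matrix) , (c , λ _ → refl) ,
  large-real-combination d≥2 matrix c m {ℤ.+ n ℤ.+ ℤ.1ℤ} {N ℤ.+ N}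
    (ℤ.+≤+ ℕ.z≤n) norm²-matrix [n+1]^d≤2N (m-bound (suc d′) 9≤N) combination-m ,
  no-combination (ℤ.<-≤-trans (ℤ.+<+ (ℕ.s≤s ℕ.z≤n)) 9≤N)
  where
  n : ℕ
  n = d ℕ.+ d

  open Construction (ℤ.+ n)
  open ConstructionBounds (ℤ.+ n) (ℤ.+≤+ (ℕ.s≤s ℕ.z≤n))
  open Coefficients (suc d′)

  n^d≡N : ℤ.+ (n ℕ.^ d) ≡ N
  n^d≡N = pos-^ n d

  9≤N : ℤ.+ 9 ≤ N
  -- Since d ≥ 2, n is at least 4 and N at least 16.
  9≤N = subst (ℤ.+ 9 ≤_) n^d≡N (ℤ.+≤+ (begin
    9          ≤⟨ ℕ.m≤m+n 9 7 ⟩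
    4 ℕ.^ 2    ≤⟨ ℕ.^-monoˡ-≤ 2 (ℕ.+-mono-≤ d≥2 d≥2) ⟩
    n ℕ.^ 2    ≤⟨ ℕ.^-monoʳ-≤ n d≥2 ⟩
    n ℕ.^ d    ∎))
    where open ℕ.≤-Reasoning

  [n+1]^d≤2N : (ℤ.+ n ℤ.+ ℤ.1ℤ) ℤ.^ d ≤ N ℤ.+ N
  [n+1]^d≤2N = begin
    (ℤ.+ (n ℕ.+ 1)) ℤ.^ d               ≡⟨ pos-^ (n ℕ.+ 1) d ⟨
    ℤ.+ ((n ℕ.+ 1) ℕ.^ d)               ≡⟨ cong (λ k → ℤ.+ (k ℕ.^ d)) (ℕ.+-comm n 1) ⟩
    ℤ.+ (suc n ℕ.^ d)                   ≤⟨ ℤ.+≤+ ([1+2d]^d≤2[2d]^d d) ⟩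
    ℤ.+ (n ℕ.^ d) ℤ.+ ℤ.+ (n ℕ.^ d)     ≡⟨ cong₂ ℤ._+_ n^d≡N n^d≡N ⟩
    N ℤ.+ N                             ∎
    where open ℤ.≤-Reasoning
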